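{- There exist an absolute constant $C>0$ and, for all integers $s\ge 2$ and $d\ge 3$, constants $\varepsilon_{d,s}>0$ and $c_{d,s}>0$ with $\varepsilon_{d,s}\le C\,s/\log d$, such that for all integers $s\ge 2$, $d\ge 3$ and any prime power $q=p^s$ with $p$ a prime greater than $s$, $$\mathrm{IM}(d,q)\ \ge\ c_{d,s}\, q^{d-\varepsilon_{d,s}}.$$
   Context: For an integer $d\ge 1$ and a prime power $q$, $\mathrm{IM}(d,q)$ denotes the maximum size of an induced matching in the bipartite point-line incidence graph of $\mathbb{F}_q^d$; equivalently, the largest $m$ for which there exist pairs $(p_1,\ell_1),\dots,(p_m,\ell_m)$ with $p_i\in\mathbb{F}_q^d$ points and $\ell_j\subset\mathbb{F}_q^d$ affine lines such that $p_i\in\ell_j$ if and only if $i=j$. -}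

module Defs where

open import Algebra.Bundles using (CommutativeRing)
import Algebra.Definitions.RawSemiring as RawSemiringDefs
open import Data.Empty using (⊥-elim)
open import Data.Fin using (Fin; zero; suc; funToFin; finToFun)
import Data.Fin.Properties as Fin
open import Data.Integer using (ℤ; +_)
import Data.Integer as ℤ
open import Data.Nat using (ℕ; zero; suc)
import Data.Nat as ℕ
import Data.Nat.Properties as ℕ
open import Data.Product using (Σ; ∃; ∃-syntax; _×_; _,_; proj₁; proj₂)
open import Data.Rational using (ℚ; 0ℚ; 1ℚ; ↥_; ↧ₙ_; _⊔_)
import Data.Rational as ℚ
open import Data.Sum using (_⊎_)
open import Data.Vec.Functional using (Vector; _∷_; head; tail)
open import Function using (_∘_; _⇔_; mk⇔; Equivalence; Inverse)
open import Level using (0ℓ)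
open import Relation.Binary.PropositionalEquality as ≡ using (_≡_; _≗_)
open import Relation.Nullary using (¬_; Dec; yes; no; map′; _×-dec_; ¬?)
open import Relation.Nullary.Decidable using (_→-dec_)

-- Real numbers as two-sided Dedekind cuts of ℚ
--
-- `Lower x r` reads r < x and `Upper x r` reads x < r.  A real is a cut
-- satisfying the Dedekind axioms.  The operations are defined on
-- bare cuts.

record Cut : Set₁ where
  field
    Lower : ℚ → Set
    Upper : ℚ → Set

open Cut public

record IsDedekind (x : Cut) : Set where
  field
    lower-inhabited : ∃ (Lower x)
    upper-inhabited : ∃ (Upper x)
    lower-rounded   : ∀ r → Lower x r ⇔ (∃[ t ] r ℚ.< t × Lower x t)
    upper-rounded   : ∀ r → Upper x r ⇔ (∃[ t ] t ℚ.< r × Upper x t)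
    disjoint        : ∀ r → ¬ (Lower x r × Upper x r)
    located         : ∀ r t → r ℚ.< t → Lower x r ⊎ Upper x t

record ℝ : Set₁ where
  field
    cut        : Cut
    isDedekind : IsDedekind cut

open ℝ public

infix  4 _≤ᶜ_ _<ᶜ_
infixl 6 _-ᶜ_
infixl 7 _*ᶜ_ _/ᶜ_
infixr 8 _^ᶜ_

_≤ᶜ_ : Cut → Cut → Set
x ≤ᶜ y = ∀ r → Lower x r → Lower y r

_<ᶜ_ : Cut → Cut → Set
x <ᶜ y = ∃[ r ] Upper x r × Lower y r

fromℚ : ℚ → Cut
fromℚ a = record { Lower = ℚ._< a ; Upper = a ℚ.<_ }

ℕ⇒ℚ : ℕ → ℚ
ℕ⇒ℚ n = + n ℚ./ 1

fromℕ : ℕ → Cut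
fromℕ n = fromℚ (ℕ⇒ℚ n)

_-ᶜ_ : Cut → Cut → Cut
x -ᶜ y = record
  { Lower = λ r → ∃[ a ] ∃[ b ] Lower x a × Upper y b × r ℚ.< a ℚ.- b
  ; Upper = λ r → ∃[ a ] ∃[ b ] Upper x a × Lower y b × a ℚ.- b ℚ.< r
  }

-- Interval arithmetic: for a < x < a′ and b < y < b′, the product xy lies
-- between the least and the greatest of the four corner products.

_*ᶜ_ : Cut → Cut → Cut
x *ᶜ y = record
  { Lower = λ r → ∃[ a ] ∃[ a′ ] ∃[ b ] ∃[ b′ ] Box a a′ b b′ ×
      r ℚ.< a ℚ.* b × r ℚ.< a ℚ.* b′ × r ℚ.< a′ ℚ.* b × r ℚ.< a′ ℚ.* b′
  ; Upper = λ r → ∃[ a ] ∃[ a′ ] ∃[ b ] ∃[ b′ ] Box a a′ b b′ ×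
      a ℚ.* b ℚ.< r × a ℚ.* b′ ℚ.< r × a′ ℚ.* b ℚ.< r × a′ ℚ.* b′ ℚ.< r
  }
  where
  Box : ℚ → ℚ → ℚ → ℚ → Set
  Box a a′ b b′ = Lower x a × Upper x a′ × Lower y b × Upper y b′

-- Meaningful only for y > 0, where every u in Upper y is positive.

recip⁺ : Cut → Cut
recip⁺ y = record
  { Lower = λ r → ∃[ u ] Upper y u × r ℚ.* u ℚ.< 1ℚ
  ; Upper = λ r → ∃[ l ] Lower y l × 0ℚ ℚ.< l × 1ℚ ℚ.< r ℚ.* l
  }

_/ᶜ_ : Cut → Cut → Cut
x /ᶜ y = x *ᶜ recip⁺ y

open RawSemiringDefs ℚ.+-*-rawSemiring public using () renaming (_^_ to _^ℚ_)

-- Comparison of r with q^t for rational t = a/b, b ≥ 1, and q ≥ 1.  With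
-- a = a⁺ − a⁻, r < q^(a/b) iff max(0,r)^b · q^(a⁻) < q^(a⁺).

module _ (q : ℕ) (t : ℚ) where
  private
    a⁺ a⁻ : ℕ
    a⁺ = ℤ.∣ ↥ t ℤ.⊔ + 0 ∣
    a⁻ = ℤ.∣ (ℤ.- (↥ t)) ℤ.⊔ + 0 ∣

  BelowPower : ℚ → Set
  BelowPower r =
    (0ℚ ⊔ r) ^ℚ (↧ₙ t) ℚ.* ℕ⇒ℚ q ^ℚ a⁻ ℚ.< ℕ⇒ℚ q ^ℚ a⁺

  AbovePower : ℚ → Set
  AbovePower r =
    0ℚ ℚ.< r × ℕ⇒ℚ q ^ℚ a⁺ ℚ.< r ^ℚ (↧ₙ t) ℚ.* ℕ⇒ℚ q ^ℚ a⁻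

-- For q ≥ 1 and real x: q^x is the supremum of q^t over rational t < x and
-- the infimum of q^t over rational t > x (when q = 1 both are 1).

_^ᶜ_ : ℕ → Cut → Cut
q ^ᶜ x = record
  { Lower = λ r → ∃[ t ] Lower x t × BelowPower q t r
  ; Upper = λ r → ∃[ t ] Upper x t × AbovePower q t r
  }

-- Natural logarithm, for d ≥ 1.  For m > −r the sequence (1 + r/m)^m
-- increases to exp r, so log d < r iff d < (1 + r/m)^m for some such m;
-- likewise r < log d iff 1 < d · exp(−r) iff 1 < d · (1 − r/m)^m for some
-- m > r.  Below m = suc k.

log : ℕ → Cut
log d = record
  { Lower = λ r → ∃[ k ] r ℚ.< ℕ⇒ℚ (suc k) ×
      1ℚ ℚ.< ℕ⇒ℚ d ℚ.* (1ℚ ℚ.- r ℚ.* (+ 1 ℚ./ suc k)) ^ℚ suc k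
  ; Upper = λ r → ∃[ k ] ℚ.- ℕ⇒ℚ (suc k) ℚ.< r ×
      ℕ⇒ℚ d ℚ.< (1ℚ ℚ.+ r ℚ.* (+ 1 ℚ./ suc k)) ^ℚ suc k
  }

record FiniteField (q : ℕ) : Set₁ where
  field
    commutativeRing : CommutativeRing 0ℓ 0ℓ

  open CommutativeRing commutativeRing public

  field
    1≉0         : ¬ (1# ≈ 0#)
    inverse     : ∀ x → ¬ (x ≈ 0#) → ∃[ y ] x * y ≈ 1#
    enumeration : Inverse setoid (≡.setoid (Fin q))

module Incidence {q : ℕ} (F : FiniteField q) (d : ℕ) where
  open FiniteField F

  Point : Set
  Point = Vector Carrier d

  -- A parametrised line; only incidence with it is used below, so different
  -- parametrisations of the same set of points are interchangeable.

  record Line : Set where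
    field
      base      : Point
      direction : Point
      nonzero   : ¬ (∀ k → direction k ≈ 0#)

  OnLine : Point → Point → Point → Set
  OnLine b v x = ∃[ t ] ∀ k → x k ≈ b k + t * v k

  infix 4 _∈_
  _∈_ : Point → Line → Set
  x ∈ l = OnLine (Line.base l) (Line.direction l) x

  record InducedMatching (m : ℕ) : Set where
    field
      point    : Fin m → Point
      line     : Fin m → Line
      incident : ∀ i j → (point i ∈ line j) ⇔ i ≡ j

  IsIM : ℕ → Set
  IsIM m = InducedMatching m × (∀ n → InducedMatching n → n ℕ.≤ m)

Exhaustible : (A : Set) → (A → A → Set) → Set₁
Exhaustible A _~_ = (P : A → Set) → (∀ {x y} → x ~ y → P x → P y) →
                    (∀ x → Dec (P x)) → Dec (∃ P)

Pointwise : {A : Set} → (A → A → Set) → ∀ n → Vector A n → Vector A n → Set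
Pointwise _~_ n f g = ∀ i → f i ~ g i

vector-exhaustible : {A : Set} {_~_ : A → A → Set} → (∀ {x} → x ~ x) →
  Exhaustible A _~_ → ∀ n → Exhaustible (Vector A n) (Pointwise _~_ n)
vector-exhaustible rfl ex zero P resp P? =
  map′ (nil ,_) (λ (f , p) → resp {x = f} {y = nil} (λ ()) p) (P? nil)
  where
  nil : Vector _ 0
  nil ()
vector-exhaustible {A} {_~_} rfl ex (suc n) P resp P? =
  map′ (λ (a , f , p) → (a ∷ f) , p)
       (λ (f , p) → head f , tail f , resp (η f) p)
       (ex (λ a → ∃ λ f → P (a ∷ f))
           (λ a~b (f , p) → f , resp (cons a~b (λ _ → rfl)) p)
           (λ a → vector-exhaustible rfl ex n (λ f → P (a ∷ f))
                    (λ f~g → resp (cons rfl f~g)) (λ f → P? (a ∷ f))))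
  where
  cons : ∀ {a b} {f g : Vector A n} → a ~ b → Pointwise _~_ n f g →
         Pointwise _~_ (suc n) (a ∷ f) (b ∷ g)
  cons p ps zero    = p
  cons p ps (suc i) = ps i

  η : (f : Vector A (suc n)) → Pointwise _~_ (suc n) f (head f ∷ tail f)
  η f zero    = rfl
  η f (suc i) = rfl

maximum : (P : ℕ → Set) → (∀ m → Dec (P m)) → P 0 →
          ∀ b → (∀ m → P m → m ℕ.≤ b) → ∃[ m ] P m × (∀ n → P n → n ℕ.≤ m)
maximum P P? p0 zero    bound = 0 , p0 , bound
maximum P P? p0 (suc b) bound with P? (suc b)
... | yes p = suc b , p , bound
... | no ¬p = maximum P P? p0 b λ m p →
  ℕ.≤-pred (ℕ.≤∧≢⇒< (bound m p) λ { ≡.refl → ¬p p })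

module _ {q : ℕ} (F : FiniteField q) (d : ℕ) where
  open FiniteField F
  open Incidence F d
  open Inverse enumeration using (to; from; to-cong; strictlyInverseʳ)
  open InducedMatching
  open Equivalence using () renaming (to to fwd; from to bwd)

  private
    injective : ∀ {x y} → to x ≡ to y → x ≈ y
    injective {x} {y} e = trans (sym (strictlyInverseʳ x))
      (trans (reflexive (≡.cong from e)) (strictlyInverseʳ y))

    ≈-dec : ∀ x y → Dec (x ≈ y)
    ≈-dec x y = map′ injective to-cong (to x Fin.≟ to y)

    carrier-exhaustible : Exhaustible Carrier _≈_
    carrier-exhaustible P resp P? =
      map′ (λ (i , p) → from i , p)
           (λ (x , p) → to x , resp (sym (strictlyInverseʳ x)) p)
           (Fin.any? (λ i → P? (from i)))

    infix 4 _≋_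
    _≋_ : Point → Point → Set
    _≋_ = Pointwise _≈_ d

    points-exhaustible : ∀ m → Exhaustible (Vector Point m) (Pointwise _≋_ m)
    points-exhaustible =
      vector-exhaustible (λ _ → refl) (vector-exhaustible refl carrier-exhaustible d)

    OnLine-resp : ∀ {b b′ v v′ x x′} → b ≋ b′ → v ≋ v′ → x ≋ x′ →
                  OnLine b v x → OnLine b′ v′ x′
    OnLine-resp b≋ v≋ x≋ (t , on) =
      t , λ k → trans (sym (x≋ k)) (trans (on k) (+-cong (b≋ k) (*-congˡ (v≋ k))))

    OnLine? : ∀ b v x → Dec (OnLine b v x)
    OnLine? b v x = carrier-exhaustible _
      (λ t≈ on k → trans (on k) (+-congˡ (*-congʳ t≈)))
      (λ t → Fin.all? (λ k → ≈-dec _ _))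

    Good : ∀ {m} (x b v : Vector Point m) → Set
    Good x b v = (∀ j → ¬ (∀ k → v j k ≈ 0#)) ×
                 (∀ i j → (OnLine (b j) (v j) (x i) → i ≡ j) ×
                          (i ≡ j → OnLine (b j) (v j) (x i)))

    Good-resp : ∀ {m} {x x′ b b′ v v′ : Vector Point m} →
      Pointwise _≋_ m x x′ → Pointwise _≋_ m b b′ → Pointwise _≋_ m v v′ →
      Good x b v → Good x′ b′ v′
    Good-resp x≋ b≋ v≋ (nz , inc) =
      (λ j z → nz j (λ k → trans (v≋ j k) (z k))) ,
      (λ i j →
        (λ on → proj₁ (inc i j) (OnLine-resp (λ k → sym (b≋ j k))
                  (λ k → sym (v≋ j k)) (λ k → sym (x≋ i k)) on)) ,
        (λ e → OnLine-resp (b≋ j) (v≋ j) (x≋ i) (proj₂ (inc i j) e)))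

    Good? : ∀ {m} (x b v : Vector Point m) → Dec (Good x b v)
    Good? x b v =
      Fin.all? (λ j → ¬? (Fin.all? λ k → ≈-dec (v j k) 0#)) ×-dec
      Fin.all? (λ i → Fin.all? λ j →
        (OnLine? (b j) (v j) (x i) →-dec (i Fin.≟ j)) ×-dec
        ((i Fin.≟ j) →-dec OnLine? (b j) (v j) (x i)))

    inducedMatching? : ∀ m → Dec (InducedMatching m)
    inducedMatching? m =
      map′ assemble split
        (points-exhaustible m _
          (λ x≋ (b , v , g) → b , v , Good-resp x≋ ≋-refl ≋-refl g)
          λ x → points-exhaustible m _
            (λ b≋ (v , g) → v , Good-resp ≋-refl b≋ ≋-refl g)
            λ b → points-exhaustible m _ (Good-resp ≋-refl ≋-refl) λ v → Good? x b v)
      where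
      ≋-refl : {x : Vector Point m} → Pointwise _≋_ m x x
      ≋-refl _ _ = refl

      assemble : (∃ λ x → ∃ λ b → ∃ λ v → Good {m} x b v) → InducedMatching m
      assemble (x , b , v , nz , inc) = record
        { point    = x
        ; line     = λ j → record { base = b j ; direction = v j ; nonzero = nz j }
        ; incident = λ i j → mk⇔ (proj₁ (inc i j)) (proj₂ (inc i j))
        }

      split : InducedMatching m → ∃ λ x → ∃ λ b → ∃ λ v → Good {m} x b v
      split M = point M , (Line.base ∘ line M) , (Line.direction ∘ line M) ,
        (Line.nonzero ∘ line M) ,
        (λ i j → fwd (incident M i j) , bwd (incident M i j))

    bounded : ∀ m → InducedMatching m → m ℕ.≤ q ℕ.^ d
    bounded m M = Fin.injective⇒≤ {f = code} code-injective
      where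
      code : Fin m → Fin (q ℕ.^ d)
      code i = funToFin (to ∘ point M i)

      decode : ∀ i → finToFun (code i) ≗ to ∘ point M i
      decode i = Fin.finToFun-funToFin (to ∘ point M i)

      code-injective : ∀ {i j} → code i ≡ code j → i ≡ j
      code-injective {i} {j} e = fwd (incident M i j)
        (OnLine-resp (λ _ → refl) (λ _ → refl)
          (λ k → injective (≡.trans (≡.sym (decode j k))
            (≡.trans (≡.cong (λ c → finToFun c k) (≡.sym e)) (decode i k))))
          (bwd (incident M j j) ≡.refl))

    empty : InducedMatching 0
    empty = record { point = λ () ; line = λ () ; incident = λ () }

  IM-exists : ∃ IsIM
  IM-exists = maximum InducedMatching inducedMatching? empty (q ℕ.^ d) bounded

  IM : ℕ
  IM = proj₁ IM-exists

{-# OPTIONS --safe #-}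

-- Write 𝔽_q = ⊕ 𝔽ₚ e_β, so that a point is an s-tuple of vectors x_β in 𝔽ₚᵈ.  For a direction w
-- with small integer entries, w₀ = 1, and x, y in a suitable box of integer vectors there is no
-- wrap-around modulo p: y lies on the line through x iff y_β = x_β + t_β w over ℤ.  So it suffices
-- to colour the box with few colours such that every x has a direction w along which the colour
-- of x_β + t w differs from that of x_β for all t ≠ 0: each colour class is an induced matching.
--
-- Put r = 2ᵏ.  The coordinates of x_β other than the first, a, are the base-ρ digits of the
-- coefficients of polynomials P₁, …, P_{r−1}.  Since P_j(a + t) + t V(a + t) = P_j(a) + tʲ can be
-- solved for V, there is a w, again made of base-ρ digits, along which each P_j(a) changes by tʲ
-- modulo N.  Hence a fixed linear combination of the P_j(a) changes by the difference of the values
-- of ∏_{0<c<r} (z − c rⁱ) at t and 0.  If t = rⁱ u with r ∤ u, this is an odd multiple of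
-- r^{i(r−1)} (r − 1)!, because r ∣ u C(u − 1, r − 1) makes C(u − 1, r − 1) even.  So one bit for
-- each i below log_r p detects every t ≠ 0.  These bits cost p^{1/k} colours per vector x_β, and
-- keeping w small enough costs another factor p^{1/k}; altogether the loss is q^{2/k}, where
-- k can be taken of order (log d − s)/4.
module Submission where

open import Data.Bool using (Bool; true; false)
open import Data.Fin using (Fin; zero; suc; toℕ; fromℕ<; funToFin; finToFun; combine; remQuot; splitAt; _↑ˡ_)
import Data.Fin.Properties as Fin
import Data.Integer as ℤ
import Data.Integer.Properties as ℤ
open import Data.Nat as ℕ using (ℕ; zero; suc; NonZero; z≤n; s≤s; _!; _%_)
import Data.Nat.DivMod as ℕ
open import Data.Nat.Primality using (Prime; prime⇒nonZero; prime⇒nonTrivial)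
import Data.Nat.Properties as ℕ
import Data.Nat.Tactic.RingSolver as ℕSolver
open import Data.Product using (∃; ∃-syntax; Σ-syntax; _,_; proj₁; proj₂; _×_)
open import Data.Sum using (_⊎_; inj₁; inj₂; [_,_]′)
open import Function using (_∘_; const; id; mk⇔; Inverse)
open import Relation.Binary.PropositionalEquality as ≡ using (_≡_; _≢_)
open import Relation.Nullary using (¬_; ¬?; Dec; yes; no; does; contradiction; map′)
open import Defs

-- Integer polynomials as coefficient vectors, and products of equally spaced linear factors.

module IntegerPolynomials where
  open import Data.Integer using (ℤ; +_; -[1+_]; _+_; _*_; _-_; -_; _^_; 0ℤ; 1ℤ; ∣_∣)
  open import Data.Integer.DivMod using (_%ℕ_; _/ℕ_; n%ℕd<d; a≡a%ℕn+[a/ℕn]*n)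
  open import Data.Integer.Tactic.RingSolver using (solve-∀)
  open import Data.Vec.Functional using (Vector; _∷_; head; tail)
  open ≡ using (refl; sym; trans; cong; cong₂; subst; module ≡-Reasoning)
  open ≡-Reasoning

  eval : ∀ {n} → Vector ℤ n → ℤ → ℤ
  eval {zero}  v T = 0ℤ
  eval {suc n} v T = head v + T * eval (tail v) T

  eval-linear : ∀ {n} (u v : Vector ℤ n) c T →
                eval (λ i → u i + c * v i) T ≡ eval u T + c * eval v T
  eval-linear {zero}  u v c T = identity c
    where
    identity : ∀ c → 0ℤ ≡ 0ℤ + c * 0ℤ
    identity = solve-∀
  eval-linear {suc n} u v c T =
    trans (cong (λ z → head u + c * head v + T * z) (eval-linear (tail u) (tail v) c T))
          (identity (head u) (head v) c T (eval (tail u) T) (eval (tail v) T))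
    where
    identity : ∀ a b c t x y → a + c * b + t * (x + c * y) ≡ a + t * x + c * (b + t * y)
    identity = solve-∀

  eval-cong : ∀ {n} {u v : Vector ℤ n} → (∀ i → u i ≡ v i) → ∀ T → eval u T ≡ eval v T
  eval-cong {zero}  e T = refl
  eval-cong {suc n} e T = cong₂ (λ x y → x + T * y) (e zero) (eval-cong (e ∘ suc) T)

  eval-zero : ∀ n T → eval {n} (const 0ℤ) T ≡ 0ℤ
  eval-zero zero    T = refl
  eval-zero (suc n) T = trans (cong (λ z → 0ℤ + T * z) (eval-zero n T)) (identity T)
    where
    identity : ∀ t → 0ℤ + t * 0ℤ ≡ 0ℤ
    identity = solve-∀

  -- Synthetic division by `T - a`: the entries of the quotient are the Horner values at `a` of the
  -- successive tails. The last of them is 0, which lets the quotient keep length `n`.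
  difference-quotient : ∀ {n} (v : Vector ℤ n) a →
    ∃[ w ] ∀ T → eval v T ≡ eval v a + (T - a) * eval {n} w T
  difference-quotient {zero}  v a = v , λ T → identity T a
    where
    identity : ∀ t a → 0ℤ ≡ 0ℤ + (t - a) * 0ℤ
    identity = solve-∀
  difference-quotient {suc n} v a with difference-quotient (tail v) a
  ... | w , e = eval (tail v) a ∷ w , λ T →
    trans (cong (λ z → head v + T * z) (e T))
          (identity (head v) T a (eval (tail v) a) (eval w T))
    where
    identity : ∀ b t a x y → b + t * (x + (t - a) * y) ≡ b + a * x + (t - a) * (x + t * y)
    identity = solve-∀

  weaken : ∀ {n} (v : Vector ℤ n) → ∃[ w ] ∀ T → eval {suc n} w T ≡ eval v T
  weaken {zero}  v = const 0ℤ , eval-zero 1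
  weaken {suc n} v with weaken (tail v)
  ... | w , e = head v ∷ w , λ T → cong (λ z → head v + T * z) (e T)

  times-linear : ∀ {n} c (v : Vector ℤ n) → ∃[ w ] ∀ T → eval {suc n} w T ≡ (T - c) * eval v T
  times-linear {n} c v with weaken v
  ... | u , e = (λ i → (0ℤ ∷ v) i + - c * u i) , λ T → begin
    eval (λ i → (0ℤ ∷ v) i + - c * u i) T        ≡⟨ eval-linear (0ℤ ∷ v) u (- c) T ⟩
    0ℤ + T * eval v T + - c * eval u T            ≡⟨ cong (λ z → 0ℤ + T * eval v T + - c * z) (e T) ⟩
    0ℤ + T * eval v T + - c * eval v T            ≡⟨ identity T c (eval v T) ⟩
    (T - c) * eval v T                             ∎
    where
    identity : ∀ t c x → 0ℤ + t * x + - c * x ≡ (t - c) * x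
    identity = solve-∀

  shifted-power : ∀ {n} a j → j ℕ.< n → ∃[ v ] ∀ T → eval {n} v T ≡ (T - a) ^ j
  shifted-power {suc n} a zero    j<n = (1ℤ ∷ const 0ℤ) , λ T →
    trans (cong (λ z → 1ℤ + T * z) (eval-zero n T)) (identity T)
    where
    identity : ∀ t → 1ℤ + t * 0ℤ ≡ 1ℤ
    identity = solve-∀
  shifted-power {suc n} a (suc j) j<n =
    let (u , e)  = shifted-power {n} a j (ℕ.≤-pred j<n)
        (v , e′) = times-linear a u
    in v , λ T → trans (e′ T) (cong ((T - a) *_) (e T))

  -- The direction V is read off from t V(a + t) = tʲ⁺¹ − (P(a + t) − P(a)), where P has coefficients B.
  tangent : ∀ {n} (B : Vector ℤ n) a j → j ℕ.< n →
    ∃[ V ] ∀ t → eval {n} (λ l → B l + t * V l) (a + t) ≡ eval B a + t ^ suc j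
  tangent {n} B a j j<n with shifted-power {n} a j j<n | difference-quotient B a
  ... | S , eS | Q , eQ = (λ l → S l + - 1ℤ * Q l) , λ t → begin
    eval (λ l → B l + t * (S l + - 1ℤ * Q l)) (a + t)
      ≡⟨ eval-linear B (λ l → S l + - 1ℤ * Q l) t (a + t) ⟩
    eval B (a + t) + t * eval (λ l → S l + - 1ℤ * Q l) (a + t)
      ≡⟨ cong₂ (λ x y → x + t * y) (eQ (a + t)) (eval-linear S Q (- 1ℤ) (a + t)) ⟩
    eval B a + (a + t - a) * eval Q (a + t) + t * (eval S (a + t) + - 1ℤ * eval Q (a + t))
      ≡⟨ cong (λ z → eval B a + (a + t - a) * eval Q (a + t) + t * (z + - 1ℤ * eval Q (a + t)))
           (trans (eS (a + t)) (cong (_^ j) (cancel a t))) ⟩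
    eval B a + (a + t - a) * eval Q (a + t) + t * (t ^ j + - 1ℤ * eval Q (a + t))
      ≡⟨ identity (eval B a) a t (eval Q (a + t)) (t ^ j) ⟩
    eval B a + t * t ^ j ∎
    where
    cancel : ∀ a t → a + t - a ≡ t
    cancel = solve-∀
    identity : ∀ b a t q s → b + (a + t - a) * q + t * (s + - 1ℤ * q) ≡ b + t * s
    identity = solve-∀

  dot : ∀ {n} → Vector ℤ n → Vector ℤ n → ℤ
  dot {zero}  g f = 0ℤ
  dot {suc n} g f = head g * head f + dot (tail g) (tail f)

  dot-linear : ∀ {n} (g u v : Vector ℤ n) c →
               dot g (λ i → u i + c * v i) ≡ dot g u + c * dot g v
  dot-linear {zero}  g u v c = identity c
    where
    identity : ∀ c → 0ℤ ≡ 0ℤ + c * 0ℤ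
    identity = solve-∀
  dot-linear {suc n} g u v c =
    trans (cong (λ z → head g * (head u + c * head v) + z) (dot-linear (tail g) (tail u) (tail v) c))
          (identity (head g) (head u) (head v) c (dot (tail g) (tail u)) (dot (tail g) (tail v)))
    where
    identity : ∀ g a b c x y → g * (a + c * b) + (x + c * y) ≡ g * a + x + c * (g * b + y)
    identity = solve-∀

  dot-cong : ∀ {n} (g : Vector ℤ n) {u v : Vector ℤ n} → (∀ i → u i ≡ v i) → dot g u ≡ dot g v
  dot-cong {zero}  g e = refl
  dot-cong {suc n} g e = cong₂ (λ x y → head g * x + y) (e zero) (dot-cong (tail g) (e ∘ suc))

  -- Index j is matched with tʲ⁺¹ because that is the amount by which the j-th polynomial value will
  -- change along a line.
  dot-powers : ∀ {n} (g : Vector ℤ n) t → dot g (λ j → t ^ suc (toℕ j)) ≡ t * eval g t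
  dot-powers {zero}  g t = identity t
    where
    identity : ∀ t → 0ℤ ≡ t * 0ℤ
    identity = solve-∀
  dot-powers {suc n} g t = begin
    head g * t ^ 1 + dot (tail g) (λ j → t * t ^ suc (toℕ j))
      ≡⟨ cong (λ z → head g * t ^ 1 + z) (dot-cong (tail g) (λ j → sym (ℤ.+-identityˡ (t * t ^ suc (toℕ j))))) ⟩
    head g * t ^ 1 + dot (tail g) (λ j → 0ℤ + t * t ^ suc (toℕ j))
      ≡⟨ cong (λ z → head g * t ^ 1 + z) (dot-linear (tail g) (const 0ℤ) (λ j → t ^ suc (toℕ j)) t) ⟩
    head g * t ^ 1 + (dot (tail g) (const 0ℤ) + t * dot (tail g) (λ j → t ^ suc (toℕ j)))
      ≡⟨ cong₂ (λ x y → head g * t ^ 1 + (x + t * y)) (dot-zero (tail g)) (dot-powers (tail g) t) ⟩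
    head g * t ^ 1 + (0ℤ + t * (t * eval (tail g) t))
      ≡⟨ identity (head g) t (eval (tail g) t) ⟩
    t * (head g + t * eval (tail g) t) ∎
    where
    dot-zero : ∀ {n} (g : Vector ℤ n) → dot g (const 0ℤ) ≡ 0ℤ
    dot-zero {zero}  g = refl
    dot-zero {suc n} g = trans (cong (λ z → head g * 0ℤ + z) (dot-zero (tail g))) (identity′ (head g))
      where
      identity′ : ∀ g → g * 0ℤ + 0ℤ ≡ 0ℤ
      identity′ = solve-∀
    identity : ∀ g t x → g * (t * 1ℤ) + (0ℤ + t * (t * x)) ≡ t * (g + t * x)
    identity = solve-∀

  -- (t − R)(t − 2R) ⋯ (t − nR)
  spaced : ℤ → ℕ → ℤ → ℤ
  spaced R zero    t = 1ℤ
  spaced R (suc n) t = (t - + suc n * R) * spaced R n t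

  spaced-poly : ∀ R n → ∃[ v ] ∀ t → eval {suc n} v t ≡ spaced R n t
  spaced-poly R zero    = const 1ℤ , identity
    where
    identity : ∀ t → 1ℤ + t * 0ℤ ≡ 1ℤ
    identity = solve-∀
  spaced-poly R (suc n) =
    let (v , e)  = spaced-poly R n
        (w , e′) = times-linear (+ suc n * R) v
    in w , λ t → trans (e′ t) (cong ((t - + suc n * R) *_) (e t))

  -- With the constant term removed, these are the coefficients of (S(t) - S(0)) / t, where S is
  -- `spaced R n`. Weighted with them, changes by t, t², ..., tⁿ add up to S(t) - S(0).
  spacedCoefficients : ∀ R n → Vector ℤ n
  spacedCoefficients R n = tail (proj₁ (spaced-poly R n))

  spaced-expand : ∀ R n t → spaced R n t ≡ spaced R n 0ℤ + t * eval (spacedCoefficients R n) t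
  spaced-expand R n t with spaced-poly R n
  ... | v , e = trans (sym (e t)) (cong (_+ t * eval (tail v) t)
                  (trans (identity (head v) (eval (tail v) 0ℤ)) (e 0ℤ)))
    where
    identity : ∀ a x → a ≡ a + 0ℤ * x
    identity = solve-∀

  spaced-scale : ∀ R n u → spaced R n (R * u) ≡ R ^ n * spaced 1ℤ n u
  spaced-scale R zero    u = refl
  spaced-scale R (suc n) u =
    trans (cong ((R * u - + suc n * R) *_) (spaced-scale R n u))
          (identity R u (+ suc n) (R ^ n) (spaced 1ℤ n u))
    where
    identity : ∀ r u m p s → (r * u - m * r) * (p * s) ≡ r * p * ((u - m * 1ℤ) * s)
    identity = solve-∀

  spaced-first : ∀ n u → spaced 1ℤ (suc n) u ≡ (u - 1ℤ) * spaced 1ℤ n (u - 1ℤ)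
  spaced-first zero    u = identity u
    where
    identity : ∀ u → (u - 1ℤ * 1ℤ) * 1ℤ ≡ (u - 1ℤ) * 1ℤ
    identity = solve-∀
  spaced-first (suc n) u =
    trans (cong ((u - + suc (suc n) * 1ℤ) *_) (spaced-first n u))
          (identity u (+ suc n) (spaced 1ℤ n (u - 1ℤ)))
    where
    identity : ∀ u m x → (u - (1ℤ + m) * 1ℤ) * ((u - 1ℤ) * x) ≡
                         (u - 1ℤ) * ((u - 1ℤ - m * 1ℤ) * x)
    identity = solve-∀

  -- Since `spaced 1ℤ n u` is n! C(u - 1, n), this is Pascal's rule multiplied by (n + 1)!.
  spaced-step : ∀ n u → spaced 1ℤ (suc n) (u + 1ℤ) ≡ spaced 1ℤ (suc n) u + + suc n * spaced 1ℤ n u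
  spaced-step n u = trans (spaced-first n (u + 1ℤ))
    (trans (cong (λ z → (u + 1ℤ - 1ℤ) * spaced 1ℤ n z) (cancel u))
           (identity u (+ suc n) (spaced 1ℤ n u)))
    where
    cancel : ∀ u → u + 1ℤ - 1ℤ ≡ u
    cancel = solve-∀
    identity : ∀ u m x → (u + 1ℤ - 1ℤ) * x ≡ (u - m * 1ℤ) * x + m * x
    identity = solve-∀

  pos-! : ∀ n → + (suc n !) ≡ + suc n * + (n !)
  pos-! n = ℤ.pos-* (suc n) (n !)

  -- Induction on `n`. For `suc n` the product vanishes at u = 1, and `spaced-step` carries
  -- divisibility from there one step up or down, so that negative `u` are reached too.
  !∣spaced : ∀ n u → ∃[ z ] spaced 1ℤ n u ≡ + (n !) * z
  !∣spaced zero    u = spaced 1ℤ 0 u , refl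
  !∣spaced (suc n) = λ where
      (+ zero)       → down 0ℤ one
      (+ suc m)      → positive m
      -[1+ m ]       → negative m
    where
    Divides : ℤ → Set
    Divides u = ∃[ z ] spaced 1ℤ (suc n) u ≡ + (suc n !) * z

    up : ∀ u → Divides u → Divides (u + 1ℤ)
    up u (z , e) with !∣spaced n u
    ... | y , e′ = z + y , (begin
      spaced 1ℤ (suc n) (u + 1ℤ)                        ≡⟨ spaced-step n u ⟩
      spaced 1ℤ (suc n) u + + suc n * spaced 1ℤ n u     ≡⟨ cong₂ (λ a b → a + + suc n * b) e e′ ⟩
      + (suc n !) * z + + suc n * (+ (n !) * y)         ≡⟨ cong (λ a → a * z + + suc n * (+ (n !) * y)) (pos-! n) ⟩
      + suc n * + (n !) * z + + suc n * (+ (n !) * y)   ≡⟨ identity (+ suc n) (+ (n !)) z y ⟩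
      + suc n * + (n !) * (z + y)                       ≡⟨ cong (_* (z + y)) (sym (pos-! n)) ⟩
      + (suc n !) * (z + y)                             ∎)
      where
      identity : ∀ m f z y → m * f * z + m * (f * y) ≡ m * f * (z + y)
      identity = solve-∀

    down : ∀ u → Divides (u + 1ℤ) → Divides u
    down u (z , e) with !∣spaced n u
    ... | y , e′ = z - y , (begin
      spaced 1ℤ (suc n) u
        ≡⟨ subtract (spaced 1ℤ (suc n) u) (+ suc n * spaced 1ℤ n u) ⟩
      spaced 1ℤ (suc n) u + + suc n * spaced 1ℤ n u - + suc n * spaced 1ℤ n u
        ≡⟨ cong₂ (λ a b → a - + suc n * b) (trans (sym (spaced-step n u)) e) e′ ⟩
      + (suc n !) * z - + suc n * (+ (n !) * y)
        ≡⟨ cong (λ a → a * z - + suc n * (+ (n !) * y)) (pos-! n) ⟩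
      + suc n * + (n !) * z - + suc n * (+ (n !) * y)
        ≡⟨ identity (+ suc n) (+ (n !)) z y ⟩
      + suc n * + (n !) * (z - y)
        ≡⟨ cong (_* (z - y)) (sym (pos-! n)) ⟩
      + (suc n !) * (z - y) ∎)
      where
      subtract : ∀ a b → a ≡ a + b - b
      subtract = solve-∀
      identity : ∀ m f z y → m * f * z - m * (f * y) ≡ m * f * (z - y)
      identity = solve-∀

    one : Divides 1ℤ
    one = 0ℤ , trans (spaced-first n 1ℤ) (sym (ℤ.*-zeroʳ (+ (suc n !))))

    positive : ∀ m → Divides (+ suc m)
    positive zero    = one
    positive (suc m) = subst Divides (cong +_ (ℕ.+-comm (suc m) 1)) (up (+ suc m) (positive m))

    negative : ∀ m → Divides -[1+ m ]
    negative zero    = down -[1+ 0 ] (down 0ℤ one)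
    negative (suc m) = down -[1+ suc m ] (negative m)

  parity : ∀ z → ∃[ b ] (z ≡ + 2 * b ⊎ z ≡ + 2 * b + 1ℤ)
  parity z with z %ℕ 2 | n%ℕd<d z 2 | a≡a%ℕn+[a/ℕn]*n z 2
  ... | 0 | _ | e = z /ℕ 2 , inj₁ (trans e (trans (ℤ.+-identityˡ _) (ℤ.*-comm (z /ℕ 2) (+ 2))))
  ... | 1 | _ | e = z /ℕ 2 , inj₂ (trans e (trans (ℤ.+-comm 1ℤ (z /ℕ 2 * + 2)) (cong (_+ 1ℤ) (ℤ.*-comm (z /ℕ 2) (+ 2)))))
  ... | suc (suc _) | ℕ.s≤s (ℕ.s≤s ()) | _

  -- An odd factor is invertible modulo 2ᵏ. Each step of the induction halves `u`: if u (2b + 1) is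
  -- even, then so is u = u (2b + 1) - 2bu.
  odd-cancel : ∀ k u b z → u * (+ 2 * b + 1ℤ) ≡ (+ 2) ^ k * z → ∃[ y ] u ≡ (+ 2) ^ k * y
  odd-cancel zero    u b z e = u , sym (ℤ.*-identityˡ u)
  odd-cancel (suc k) u b z e = proj₁ rest , (begin
    u                              ≡⟨ even ⟩
    + 2 * u′                       ≡⟨ cong (+ 2 *_) (proj₂ rest) ⟩
    + 2 * ((+ 2) ^ k * proj₁ rest) ≡⟨ sym (ℤ.*-assoc (+ 2) ((+ 2) ^ k) (proj₁ rest)) ⟩
    + 2 * (+ 2) ^ k * proj₁ rest   ∎)
    where
    u′ = (+ 2) ^ k * z - b * u
    even : u ≡ + 2 * u′
    even = begin
      u                                       ≡⟨ isolate u b ⟩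
      u * (+ 2 * b + 1ℤ) - + 2 * (b * u)      ≡⟨ cong (_- + 2 * (b * u)) e ⟩
      + 2 * (+ 2) ^ k * z - + 2 * (b * u)     ≡⟨ factor ((+ 2) ^ k) z b u ⟩
      + 2 * u′                                ∎
      where
      isolate : ∀ u b → u ≡ u * (+ 2 * b + 1ℤ) - + 2 * (b * u)
      isolate = solve-∀
      factor : ∀ p z b u → + 2 * p * z - + 2 * (b * u) ≡ + 2 * (p * z - b * u)
      factor = solve-∀
    halved : u′ * (+ 2 * b + 1ℤ) ≡ (+ 2) ^ k * z
    halved = ℤ.*-cancelˡ-≡ (+ 2) _ _ (begin
      + 2 * (u′ * (+ 2 * b + 1ℤ))  ≡⟨ sym (ℤ.*-assoc (+ 2) u′ _) ⟩
      + 2 * u′ * (+ 2 * b + 1ℤ)    ≡⟨ cong (_* (+ 2 * b + 1ℤ)) (sym even) ⟩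
      u * (+ 2 * b + 1ℤ)           ≡⟨ e ⟩
      + 2 * (+ 2) ^ k * z          ≡⟨ ℤ.*-assoc (+ 2) ((+ 2) ^ k) z ⟩
      + 2 * ((+ 2) ^ k * z)        ∎)
    rest = odd-cancel k u′ b z halved

  -- The value is (-1)ⁿ n!; what matters later is that the cofactor of n! is odd.
  spaced-at-0 : ∀ n → ∃[ b ] spaced 1ℤ n 0ℤ ≡ + (n !) * (+ 2 * b + 1ℤ)
  spaced-at-0 zero    = 0ℤ , refl
  spaced-at-0 (suc n) with spaced-at-0 n
  ... | b , e = - b - 1ℤ , (begin
    (0ℤ - + suc n * 1ℤ) * spaced 1ℤ n 0ℤ                  ≡⟨ cong ((0ℤ - + suc n * 1ℤ) *_) e ⟩
    (0ℤ - + suc n * 1ℤ) * (+ (n !) * (+ 2 * b + 1ℤ))      ≡⟨ identity (+ suc n) (+ (n !)) b ⟩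
    + suc n * + (n !) * (+ 2 * (- b - 1ℤ) + 1ℤ)           ≡⟨ cong (_* (+ 2 * (- b - 1ℤ) + 1ℤ)) (sym (pos-! n)) ⟩
    + (suc n !) * (+ 2 * (- b - 1ℤ) + 1ℤ)                 ∎)
    where
    identity : ∀ m f b → (0ℤ - m * 1ℤ) * (f * (+ 2 * b + 1ℤ)) ≡ m * f * (+ 2 * (- b - 1ℤ) + 1ℤ)
    identity = solve-∀

  -- u · spaced 1 n u is a product of n + 1 = 2ᵏ consecutive integers, hence divisible by 2ᵏ · n!.
  spaced-even : ∀ k n → + suc n ≡ (+ 2) ^ k → ∀ u → ¬ (∃[ y ] u ≡ (+ 2) ^ k * y) →
                ∃[ b ] spaced 1ℤ n u ≡ + (n !) * (+ 2 * b)
  spaced-even k n n+1≡2^k u 2^k∤u with !∣spaced n u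
  ... | z , e with parity z
  ... | b , inj₁ even = b , trans e (cong (+ (n !) *_) even)
  ... | b , inj₂ odd  = contradiction (odd-cancel k u b y cancelled) 2^k∤u
    where
    y = proj₁ (!∣spaced (suc n) (u + 1ℤ))
    instance _ = n ℕ.!≢0
    cancelled : u * (+ 2 * b + 1ℤ) ≡ (+ 2) ^ k * y
    cancelled = ℤ.*-cancelˡ-≡ (+ (n !)) _ _ (begin
      + (n !) * (u * (+ 2 * b + 1ℤ))      ≡⟨ rotate (+ (n !)) u (+ 2 * b + 1ℤ) ⟩
      u * (+ (n !) * (+ 2 * b + 1ℤ))      ≡⟨ cong (u *_) (trans (cong (+ (n !) *_) (sym odd)) (sym e)) ⟩
      u * spaced 1ℤ n u                    ≡⟨ cong (λ v → v * spaced 1ℤ n v) (cancel u) ⟩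
      (u + 1ℤ - 1ℤ) * spaced 1ℤ n (u + 1ℤ - 1ℤ) ≡⟨ sym (spaced-first n (u + 1ℤ)) ⟩
      spaced 1ℤ (suc n) (u + 1ℤ)           ≡⟨ proj₂ (!∣spaced (suc n) (u + 1ℤ)) ⟩
      + (suc n !) * y                      ≡⟨ cong (_* y) (pos-! n) ⟩
      + suc n * + (n !) * y                ≡⟨ cong (λ m → m * + (n !) * y) n+1≡2^k ⟩
      (+ 2) ^ k * + (n !) * y              ≡⟨ swap ((+ 2) ^ k) (+ (n !)) y ⟩
      + (n !) * ((+ 2) ^ k * y)            ∎)
      where
      rotate : ∀ f u v → f * (u * v) ≡ u * (f * v)
      rotate = solve-∀
      cancel : ∀ u → u ≡ u + 1ℤ - 1ℤ
      cancel = solve-∀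
      swap : ∀ p f y → p * f * y ≡ f * (p * y)
      swap = solve-∀

  -- The cofactor of n! is even at `u` by `spaced-even` and odd at 0 by `spaced-at-0`, so the
  -- difference is an odd multiple of n!. Passing from spacing 1 to spacing `R` multiplies
  -- everything by Rⁿ.
  spaced-change : ∀ k n → + suc n ≡ (+ 2) ^ k → ∀ R u → ¬ (∃[ y ] u ≡ (+ 2) ^ k * y) →
    ∃[ b ] spaced R n (R * u) ≡ spaced R n 0ℤ + R ^ n * + (n !) * (+ 2 * b + 1ℤ)
  spaced-change k n n+1≡2^k R u 2^k∤u with spaced-even k n n+1≡2^k u 2^k∤u | spaced-at-0 n
  ... | b , e | c , e₀ = b - c - 1ℤ , (begin
    spaced R n (R * u)                    ≡⟨ spaced-scale R n u ⟩
    R ^ n * spaced 1ℤ n u                 ≡⟨ cong (R ^ n *_) e ⟩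
    R ^ n * (+ (n !) * (+ 2 * b))         ≡⟨ identity (R ^ n) (+ (n !)) b c ⟩
    R ^ n * (+ (n !) * (+ 2 * c + 1ℤ)) + R ^ n * + (n !) * (+ 2 * (b - c - 1ℤ) + 1ℤ)
      ≡⟨ cong (λ z → R ^ n * z + R ^ n * + (n !) * (+ 2 * (b - c - 1ℤ) + 1ℤ)) (sym e₀) ⟩
    R ^ n * spaced 1ℤ n 0ℤ + R ^ n * + (n !) * (+ 2 * (b - c - 1ℤ) + 1ℤ)
      ≡⟨ cong (_+ R ^ n * + (n !) * (+ 2 * (b - c - 1ℤ) + 1ℤ))
           (trans (sym (spaced-scale R n 0ℤ)) (cong (spaced R n) (ℤ.*-zeroʳ R))) ⟩
    spaced R n 0ℤ + R ^ n * + (n !) * (+ 2 * (b - c - 1ℤ) + 1ℤ) ∎)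
    where
    identity : ∀ p f b c → p * (f * (+ 2 * b)) ≡
      p * (f * (+ 2 * c + 1ℤ)) + p * f * (+ 2 * (b - c - 1ℤ) + 1ℤ)
    identity = solve-∀

  digits : ∀ K ρ V → V ℕ.< ρ ℕ.^ K →
    Σ[ δ ∈ Vector ℕ K ] (∀ i → δ i ℕ.< ρ) × eval {K} (λ i → + (δ i)) (+ ρ) ≡ + V
  digits zero    ρ       zero V< = (λ ()) , (λ ()) , refl
  digits zero    ρ       (suc V) (ℕ.s≤s ())
  digits (suc K) (suc ρ) V V< with digits K (suc ρ) (V ℕ./ suc ρ)
                                     (ℕ.m<n*o⇒m/o<n (subst (V ℕ.<_) (ℕ.*-comm (suc ρ) _) V<))
  ... | δ , δ< , e = (V ℕ.% suc ρ ∷ δ) ,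
    (λ { zero → ℕ.m%n<n V (suc ρ) ; (suc i) → δ< i }) ,
    (begin
      + (V ℕ.% suc ρ) + + suc ρ * eval (λ i → + (δ i)) (+ suc ρ)
        ≡⟨ cong (λ z → + (V ℕ.% suc ρ) + + suc ρ * z) e ⟩
      + (V ℕ.% suc ρ) + + suc ρ * + (V ℕ./ suc ρ)
        ≡⟨ cong (λ z → + (V ℕ.% suc ρ) + z) (sym (ℤ.pos-* (suc ρ) _)) ⟩
      + (V ℕ.% suc ρ ℕ.+ suc ρ ℕ.* (V ℕ./ suc ρ))
        ≡⟨ cong +_ (trans (cong (V ℕ.% suc ρ ℕ.+_) (ℕ.*-comm (suc ρ) _)) (sym (ℕ.m≡m%n+[m/n]*n V (suc ρ)))) ⟩
      + V ∎)

-- Colouring a single vector by bits of polynomial values, one bit for each power of r.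

module LevelColouring where
  open import Data.Integer using (ℤ; +_; _+_; _*_; _-_; -_; _^_; 0ℤ; 1ℤ; ∣_∣)
  open import Data.Integer.DivMod using (_%ℕ_; _/ℕ_; n%ℕd<d; a≡a%ℕn+[a/ℕn]*n)
  open import Data.Integer.Tactic.RingSolver using (solve-∀)
  open import Data.Vec.Functional using (Vector)
  open ≡ using (refl; sym; trans; cong; cong₂; subst; module ≡-Reasoning)
  open IntegerPolynomials
  open ≡-Reasoning

  odd≢0 : ∀ c → + 2 * c + 1ℤ ≢ 0ℤ
  odd≢0 c e = even≢1 ∣ c ∣ (trans (sym (ℤ.abs-* (+ 2) c)) (cong ∣_∣ (trans (isolate c) (cong (_- 1ℤ) e))))
    where
    isolate : ∀ c → + 2 * c ≡ + 2 * c + 1ℤ - 1ℤ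
    isolate = solve-∀
    even≢1 : ∀ n → 2 ℕ.* n ≢ 1
    even≢1 (suc n) e with trans (sym (ℕ.+-suc n (n ℕ.+ 0))) (ℕ.suc-injective e)
    ... | ()

  ∣m-n∣<o : ∀ {m n o} → m ℕ.< n ℕ.+ o → n ℕ.< m ℕ.+ o → ∣ + m - + n ∣ ℕ.< o
  ∣m-n∣<o {m} {n} {o} m< n< with ℕ.≤-total m n
  ... | inj₁ m≤n = subst (ℕ._< o) (sym (trans (cong ∣_∣ (ℤ.m-n≡m⊖n m n)) (ℤ.∣⊖∣-≤ m≤n)))
                     (ℕ.+-cancelˡ-< m _ _ (subst (ℕ._< m ℕ.+ o) (sym (ℕ.m+[n∸m]≡n m≤n)) n<))
  ... | inj₂ n≤m = subst (ℕ._< o) (sym (trans (cong ∣_∣ (ℤ.m-n≡m⊖n m n)) (trans (ℤ.∣m⊖n∣≡∣n⊖m∣ m n) (ℤ.∣⊖∣-≤ n≤m))))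
                     (ℕ.+-cancelˡ-< n _ _ (subst (ℕ._< n ℕ.+ o) (sym (ℕ.m+[n∸m]≡n n≤m)) m<))

  same-answer : ∀ {P Q : Set} (p? : Dec P) (q? : Dec Q) → does p? ≡ does q? → (P × Q) ⊎ (¬ P × ¬ Q)
  same-answer (yes p) (yes q) _ = inj₁ (p , q)
  same-answer (no ¬p) (no ¬q) _ = inj₂ (¬p , ¬q)

  module _ (Z : ℕ) .{{_ : NonZero Z}} where
    private instance
      2Z≢0 : NonZero (2 ℕ.* Z)
      2Z≢0 = ℕ.m*n≢0 2 Z

    highBit : ℤ → Bool
    highBit Φ = does (Φ %ℕ (2 ℕ.* Z) ℕ.<? Z)

    -- Equal bits would put both residues modulo 2Z into the same half, at distance less than Z. But
    -- they differ by Z times an odd integer, hence by at least Z.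
    highBit-flip : ∀ Φ c → highBit (Φ + + Z * (+ 2 * c + 1ℤ)) ≢ highBit Φ
    highBit-flip Φ c same = contradiction (close same) (ℕ.≤⇒≯ far)
      where
      Φ′ = Φ + + Z * (+ 2 * c + 1ℤ)
      α  = Φ %ℕ (2 ℕ.* Z)
      α′ = Φ′ %ℕ (2 ℕ.* Z)
      d = Φ /ℕ (2 ℕ.* Z) + c - Φ′ /ℕ (2 ℕ.* Z)

      difference : + α′ - + α ≡ + Z * (+ 2 * d + 1ℤ)
      difference = begin
        + α′ - + α
          ≡⟨ add-back (+ α′) (+ α) (Φ′ /ℕ (2 ℕ.* Z)) (Φ /ℕ (2 ℕ.* Z)) (+ (2 ℕ.* Z)) ⟩
        (+ α′ + Φ′ /ℕ (2 ℕ.* Z) * + (2 ℕ.* Z)) - (+ α + Φ /ℕ (2 ℕ.* Z) * + (2 ℕ.* Z))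
          + (Φ /ℕ (2 ℕ.* Z) - Φ′ /ℕ (2 ℕ.* Z)) * + (2 ℕ.* Z)
          ≡⟨ cong₂ (λ x y → x - y + (Φ /ℕ (2 ℕ.* Z) - Φ′ /ℕ (2 ℕ.* Z)) * + (2 ℕ.* Z))
               (sym (a≡a%ℕn+[a/ℕn]*n Φ′ (2 ℕ.* Z))) (sym (a≡a%ℕn+[a/ℕn]*n Φ (2 ℕ.* Z))) ⟩
        Φ + + Z * (+ 2 * c + 1ℤ) - Φ + (Φ /ℕ (2 ℕ.* Z) - Φ′ /ℕ (2 ℕ.* Z)) * + (2 ℕ.* Z)
          ≡⟨ cong (λ y → Φ + + Z * (+ 2 * c + 1ℤ) - Φ + (Φ /ℕ (2 ℕ.* Z) - Φ′ /ℕ (2 ℕ.* Z)) * y) (ℤ.pos-* 2 Z) ⟩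
        Φ + + Z * (+ 2 * c + 1ℤ) - Φ + (Φ /ℕ (2 ℕ.* Z) - Φ′ /ℕ (2 ℕ.* Z)) * (+ 2 * + Z)
          ≡⟨ collect Φ (+ Z) c (Φ /ℕ (2 ℕ.* Z)) (Φ′ /ℕ (2 ℕ.* Z)) ⟩
        + Z * (+ 2 * d + 1ℤ) ∎
        where
        add-back : ∀ a b x y m → a - b ≡ (a + x * m) - (b + y * m) + (y - x) * m
        add-back = solve-∀
        collect : ∀ f z c x y → f + z * (+ 2 * c + 1ℤ) - f + (x - y) * (+ 2 * z) ≡
                                z * (+ 2 * (x + c - y) + 1ℤ)
        collect = solve-∀

      far : Z ℕ.≤ ∣ + α′ - + α ∣
      far = subst (Z ℕ.≤_) (sym (trans (cong ∣_∣ difference) (ℤ.abs-* (+ Z) (+ 2 * d + 1ℤ))))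
        (ℕ.m≤m*n Z ∣ + 2 * d + 1ℤ ∣ {{ℕ.≢-nonZero (λ e → odd≢0 d (ℤ.∣i∣≡0⇒i≡0 e))}})

      <2Z : ∀ Ψ → Ψ %ℕ (2 ℕ.* Z) ℕ.< Z ℕ.+ Z
      <2Z Ψ = subst (Ψ %ℕ (2 ℕ.* Z) ℕ.<_) (cong (Z ℕ.+_) (ℕ.+-identityʳ Z)) (n%ℕd<d Ψ (2 ℕ.* Z))

      close : highBit Φ′ ≡ highBit Φ → ∣ + α′ - + α ∣ ℕ.< Z
      close eq with same-answer (α′ ℕ.<? Z) (α ℕ.<? Z) eq
      ... | inj₁ (a , b) = ∣m-n∣<o (ℕ.≤-trans a (ℕ.m≤n+m Z α)) (ℕ.≤-trans b (ℕ.m≤n+m Z α′))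
      ... | inj₂ (a , b) = ∣m-n∣<o (ℕ.<-≤-trans (<2Z Φ′) (ℕ.+-monoˡ-≤ Z (ℕ.≮⇒≥ b)))
                                   (ℕ.<-≤-trans (<2Z Φ) (ℕ.+-monoˡ-≤ Z (ℕ.≮⇒≥ a)))

  -- Divide by `r` until a nonzero remainder appears; the bound by r^J stops this within J steps. As
  -- `r` will be 2ᵏ, the cofactor `u` may still be even: that it is no multiple of `r` is what
  -- `spaced-even` asks for.
  valuation : ∀ r .{{_ : NonZero r}} J t → t ≢ 0ℤ → ∣ t ∣ ℕ.< r ℕ.^ J →
    Σ[ i ∈ Fin J ] Σ[ u ∈ ℤ ] t ≡ + (r ℕ.^ toℕ i) * u × ¬ (∃[ y ] u ≡ + r * y)
  valuation r zero    t t≢0 t< = contradiction (ℤ.∣i∣≡0⇒i≡0 (ℕ.n<1⇒n≡0 t<)) t≢0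
  valuation r (suc J) t t≢0 t< with t %ℕ r in rem | n%ℕd<d t r | a≡a%ℕn+[a/ℕn]*n t r
  ... | suc m | m<r | e = zero , t , sym (ℤ.*-identityˡ t) , λ (y , t≡ry) →
    not-multiple ∣ y - t /ℕ r ∣ (trans (cong ∣_∣ (trans (isolate (+ suc m) (t /ℕ r * + r))
      (trans (cong (_- t /ℕ r * + r) (trans (sym e) t≡ry)) (factor (+ r) y (t /ℕ r)))))
      (ℤ.abs-* (+ r) (y - t /ℕ r)))
    where
    isolate : ∀ x y → x ≡ x + y - y
    isolate = solve-∀
    factor : ∀ r y q → r * y - q * r ≡ r * (y - q)
    factor = solve-∀
    not-multiple : ∀ n → suc m ≢ r ℕ.* n
    not-multiple zero    e = contradiction (trans e (ℕ.*-zeroʳ r)) λ ()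
    not-multiple (suc n) e = ℕ.<⇒≱ m<r (subst (r ℕ.≤_) (sym e) (ℕ.m≤m*n r (suc n)))
  ... | zero | _ | e with valuation r J (t /ℕ r)
      (λ q≡0 → t≢0 (trans e (cong (λ q → 0ℤ + q * + r) q≡0)))
      (ℕ.*-cancelˡ-< r _ _ (subst (ℕ._< r ℕ.^ suc J)
        (trans (cong ∣_∣ (trans e (trans (ℤ.+-identityˡ _) (ℤ.*-comm (t /ℕ r) (+ r))))) (ℤ.abs-* (+ r) (t /ℕ r))) t<))
  ... | i , u , e′ , r∤u = suc i , u , (begin
    t                                ≡⟨ e ⟩
    0ℤ + t /ℕ r * + r                ≡⟨ cong (λ q → 0ℤ + q * + r) e′ ⟩
    0ℤ + + (r ℕ.^ toℕ i) * u * + r   ≡⟨ rotate (+ (r ℕ.^ toℕ i)) u (+ r) ⟩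
    + r * + (r ℕ.^ toℕ i) * u        ≡⟨ cong (_* u) (sym (ℤ.pos-* r (r ℕ.^ toℕ i))) ⟩
    + (r ℕ.^ suc (toℕ i)) * u        ∎) , r∤u
    where
    rotate : ∀ p u r → 0ℤ + p * u * r ≡ r * p * u
    rotate = solve-∀

  pos-^ : ∀ m n → + (m ℕ.^ n) ≡ (+ m) ^ n
  pos-^ m zero    = refl
  pos-^ m (suc n) = trans (ℤ.pos-* m (m ℕ.^ n)) (cong (+ m *_) (pos-^ m n))

  *-^ : ∀ m n o → (m ℕ.* n) ℕ.^ o ≡ m ℕ.^ o ℕ.* n ℕ.^ o
  *-^ m n zero    = refl
  *-^ m n (suc o) = trans (cong (m ℕ.* n ℕ.*_) (*-^ m n o)) (ℕ.[m*n]*[o*p]≡[m*o]*[n*p] m n _ _)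

  -- The coordinates b are the base-ρ digits of the coefficients of D polynomials of degree < D, whose
  -- values at a are form b a; level i combines these values so that along the direction `slope` it
  -- changes like spaced rⁱ D, modulo N.
  module Block (D K ρ J : ℕ) where
    r : ℕ
    r = suc D

    -- This is twice `height J`, hence a multiple of 2 `height i` for every level i below J. Errors
    -- that are multiples of `N` therefore never affect a bit.
    N : ℕ
    N = 2 ℕ.* (((r ℕ.^ J) ℕ.^ D) ℕ.* D !)

    instance
      N≢0 : NonZero N
      N≢0 = ℕ.m*n≢0 2 _ {{_}} {{ℕ.m*n≢0 _ _ {{ℕ.m^n≢0 (r ℕ.^ J) D {{ℕ.m^n≢0 r J}}}} {{D ℕ.!≢0}}}}

    -- The number whose odd multiples `spaced-change` yields for R = rⁱ.
    height : ℕ → ℕ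
    height i = (r ℕ.^ i) ℕ.^ D ℕ.* D !

    height≢0 : ∀ i → NonZero (height i)
    height≢0 i = ℕ.m*n≢0 _ _ {{ℕ.m^n≢0 (r ℕ.^ i) D {{ℕ.m^n≢0 r i}}}} {{D ℕ.!≢0}}

    Coordinates : Set → Set
    Coordinates A = Fin D → Fin D → Fin K → A

    form : Coordinates ℤ → ℤ → Vector ℤ D
    form b a j = eval (λ l → eval (b j l) (+ ρ)) a

    level : ℕ → ℤ → Coordinates ℤ → ℤ
    level i a b = dot (spacedCoefficients (+ (r ℕ.^ i)) D) (form b a)

    levelBit : Fin J → ℤ → Coordinates ℤ → Bool
    levelBit i a b = highBit (height (toℕ i)) {{height≢0 (toℕ i)}} (level (toℕ i) a b)

    abstract
      bit : Fin J → ℤ → Coordinates ℤ → Bool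
      bit = levelBit

      bit-cong : ∀ i {a a′ b b′} → a ≡ a′ → (∀ j l κ → b j l κ ≡ b′ j l κ) → bit i a b ≡ bit i a′ b′
      bit-cong i {a} refl b≡ = cong (highBit (height (toℕ i)) {{height≢0 (toℕ i)}})
        (dot-cong (spacedCoefficients (+ (r ℕ.^ toℕ i)) D)
          (λ j → eval-cong (λ l → eval-cong (λ κ → b≡ j l κ) (+ ρ)) a))

    module _ (N≤ρ^K : N ℕ.≤ ρ ℕ.^ K) (a : ℤ) (b : Coordinates ℤ) where
      private
        B : Fin D → Vector ℤ D
        B j l = eval (b j l) (+ ρ)

        V : Fin D → Vector ℤ D
        V j = proj₁ (tangent (B j) a (toℕ j) (Fin.toℕ<n j))

        -- The direction has to be right modulo `N` only, so `V` is replaced by its residue, and N ≤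
        -- ρᴷ makes room for the residue in K digits below ρ. This is what keeps the slope small.
        digit : ∀ j l → Σ[ δ ∈ Vector ℕ K ] (∀ κ → δ κ ℕ.< ρ) × eval {K} (λ κ → + (δ κ)) (+ ρ) ≡ + (V j l %ℕ N)
        digit j l = digits K ρ (V j l %ℕ N) (ℕ.<-≤-trans (n%ℕd<d (V j l) N) N≤ρ^K)

      abstract
        slope : Coordinates ℕ
        slope j l = proj₁ (digit j l)

        slope< : ∀ j l κ → slope j l κ ℕ.< ρ
        slope< j l = proj₁ (proj₂ (digit j l))

      along : ℤ → Coordinates ℤ
      along t j l κ = b j l κ + t * + (slope j l κ)

      abstract
        -- By linearity in the coefficients, using the residue V - N ⌊V / N⌋ in place of V alters
        -- the value given by `tangent` by a multiple of `N`; the witness is read off from the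
        -- quotients.
        along-form : ∀ t j → ∃[ z ] form (along t) (a + t) j ≡ form b a j + t ^ suc (toℕ j) + + N * z
        along-form t j = - (t * eval (λ l → V j l /ℕ N) (a + t)) , (begin
          eval (λ l → eval (along t j l) (+ ρ)) (a + t)
            ≡⟨ eval-cong (λ l → trans (eval-linear (b j l) (λ κ → + slope j l κ) t (+ ρ))
                 (cong (λ z → B j l + t * z) (trans (proj₂ (proj₂ (digit j l))) (remainder l)))) (a + t) ⟩
          eval (λ l → B j l + t * (V j l + - + N * (V j l /ℕ N))) (a + t)
            ≡⟨ eval-cong (λ l → expand (B j l) t (V j l) (+ N) (V j l /ℕ N)) (a + t) ⟩
          eval (λ l → (B j l + t * V j l) + - (t * + N) * (V j l /ℕ N)) (a + t)
            ≡⟨ eval-linear (λ l → B j l + t * V j l) (λ l → V j l /ℕ N) (- (t * + N)) (a + t) ⟩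
          eval (λ l → B j l + t * V j l) (a + t) + - (t * + N) * eval (λ l → V j l /ℕ N) (a + t)
            ≡⟨ cong₂ _+_ (proj₂ (tangent (B j) a (toℕ j) (Fin.toℕ<n j)) t)
                 (regroup t (+ N) (eval (λ l → V j l /ℕ N) (a + t))) ⟩
          form b a j + t ^ suc (toℕ j) + + N * - (t * eval (λ l → V j l /ℕ N) (a + t)) ∎)
          where
          remainder : ∀ l → + (V j l %ℕ N) ≡ V j l + - + N * (V j l /ℕ N)
          remainder l = trans (isolate (+ (V j l %ℕ N)) (V j l /ℕ N) (+ N))
            (cong (_+ - + N * (V j l /ℕ N)) (sym (a≡a%ℕn+[a/ℕn]*n (V j l) N)))
            where
            isolate : ∀ x q n → x ≡ x + q * n + - n * q
            isolate = solve-∀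
          expand : ∀ b t v n q → b + t * (v + - n * q) ≡ (b + t * v) + - (t * n) * q
          expand = solve-∀
          regroup : ∀ t n e → - (t * n) * e ≡ n * - (t * e)
          regroup = solve-∀

      -- The weights `g` combine the changes tʲ⁺¹ into t g(t), which is S(t) - S(0) by
      -- `spaced-expand`.
      along-level : ∀ i t → ∃[ z ] level i (a + t) (along t) ≡
        level i a b + (spaced (+ (r ℕ.^ i)) D t - spaced (+ (r ℕ.^ i)) D 0ℤ) + + N * z
      along-level i t = dot g z , (begin
        dot g (form (along t) (a + t))
          ≡⟨ dot-cong g (λ j → proj₂ (along-form t j)) ⟩
        dot g (λ j → form b a j + t ^ suc (toℕ j) + + N * z j)
          ≡⟨ dot-linear g (λ j → form b a j + t ^ suc (toℕ j)) z (+ N) ⟩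
        dot g (λ j → form b a j + t ^ suc (toℕ j)) + + N * dot g z
          ≡⟨ cong (_+ + N * dot g z) (dot-cong g (λ j → cong (λ y → form b a j + y) (sym (ℤ.*-identityˡ (t ^ suc (toℕ j)))))) ⟩
        dot g (λ j → form b a j + 1ℤ * t ^ suc (toℕ j)) + + N * dot g z
          ≡⟨ cong (_+ + N * dot g z) (dot-linear g (form b a) (λ j → t ^ suc (toℕ j)) 1ℤ) ⟩
        level i a b + 1ℤ * dot g (λ j → t ^ suc (toℕ j)) + + N * dot g z
          ≡⟨ cong (λ y → level i a b + y + + N * dot g z) (trans (ℤ.*-identityˡ _) (trans (dot-powers g t) change)) ⟩
        level i a b + (spaced R D t - spaced R D 0ℤ) + + N * dot g z ∎)
        where
        R = + (r ℕ.^ i)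
        g = spacedCoefficients R D
        z = λ j → proj₁ (along-form t j)
        change : t * eval g t ≡ spaced R D t - spaced R D 0ℤ
        change = trans (isolate (spaced R D 0ℤ) (t * eval g t)) (cong (_- spaced R D 0ℤ) (sym (spaced-expand R D t)))
          where
          isolate : ∀ x y → y ≡ x + y - x
          isolate = solve-∀

      -- The level is the exponent i in t = rⁱ u with r ∤ u. There S(t) - S(0) is an odd multiple of
      -- `height i`, while the error, a multiple of `N`, is an even one; so `highBit-flip` applies
      -- to their sum.
      levelBit-changes : ∀ k → r ≡ 2 ℕ.^ k → ∀ t → t ≢ 0ℤ → ∣ t ∣ ℕ.< r ℕ.^ J →
        ∃[ i ] levelBit i (a + t) (along t) ≢ levelBit i a b
      levelBit-changes k r≡2^k t t≢0 t< with valuation r J t t≢0 t<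
      ... | i , u , t≡Ru , r∤u = i , λ same →
        highBit-flip Z Φ (c + n * z) (trans (cong (highBit Z) (sym total)) same)
        where
        I = toℕ i
        R = + (r ℕ.^ I)
        Z = height I
        Φ = level I a b
        -- The quotient N / (2Z).
        n = + ((r ℕ.^ (J ℕ.∸ I)) ℕ.^ D)
        instance _ = height≢0 I

        r≡2^k′ : + r ≡ (+ 2) ^ k
        r≡2^k′ = trans (cong +_ r≡2^k) (pos-^ 2 k)

        change = spaced-change k D r≡2^k′ R u
                   (λ (y , e) → r∤u (y , trans e (cong (_* y) (sym r≡2^k′))))
        c = proj₁ change
        z = proj₁ (along-level I t)

        Z≡ : + Z ≡ R ^ D * + (D !)
        Z≡ = trans (ℤ.pos-* ((r ℕ.^ I) ℕ.^ D) (D !)) (cong (_* + (D !)) (pos-^ (r ℕ.^ I) D))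

        N≡ : + N ≡ + 2 * + Z * n
        N≡ = trans (cong +_ (begin
          2 ℕ.* ((r ℕ.^ J) ℕ.^ D ℕ.* D !)
            ≡⟨ cong (λ e → 2 ℕ.* ((r ℕ.^ e) ℕ.^ D ℕ.* D !)) (sym (ℕ.m+[n∸m]≡n (ℕ.<⇒≤ (Fin.toℕ<n i)))) ⟩
          2 ℕ.* ((r ℕ.^ (I ℕ.+ (J ℕ.∸ I))) ℕ.^ D ℕ.* D !)
            ≡⟨ cong (λ e → 2 ℕ.* (e ℕ.^ D ℕ.* D !)) (ℕ.^-distribˡ-+-* r I (J ℕ.∸ I)) ⟩
          2 ℕ.* ((r ℕ.^ I ℕ.* r ℕ.^ (J ℕ.∸ I)) ℕ.^ D ℕ.* D !)
            ≡⟨ cong (λ e → 2 ℕ.* (e ℕ.* D !)) (*-^ (r ℕ.^ I) (r ℕ.^ (J ℕ.∸ I)) D) ⟩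
          2 ℕ.* ((r ℕ.^ I) ℕ.^ D ℕ.* (r ℕ.^ (J ℕ.∸ I)) ℕ.^ D ℕ.* D !)
            ≡⟨ shuffle ((r ℕ.^ I) ℕ.^ D) ((r ℕ.^ (J ℕ.∸ I)) ℕ.^ D) (D !) ⟩
          2 ℕ.* Z ℕ.* (r ℕ.^ (J ℕ.∸ I)) ℕ.^ D ∎))
          (trans (ℤ.pos-* (2 ℕ.* Z) _) (cong (_* n) (ℤ.pos-* 2 Z)))
          where
          shuffle : ∀ x y f → 2 ℕ.* (x ℕ.* y ℕ.* f) ≡ 2 ℕ.* (x ℕ.* f) ℕ.* y
          shuffle = ℕSolver.solve-∀

        total : level I (a + t) (along t) ≡ Φ + + Z * (+ 2 * (c + n * z) + 1ℤ)
        total = begin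
          level I (a + t) (along t)
            ≡⟨ proj₂ (along-level I t) ⟩
          Φ + (spaced R D t - spaced R D 0ℤ) + + N * z
            ≡⟨ cong (λ w → Φ + (w - spaced R D 0ℤ) + + N * z) (trans (cong (spaced R D) t≡Ru) (proj₂ change)) ⟩
          Φ + (spaced R D 0ℤ + R ^ D * + (D !) * (+ 2 * c + 1ℤ) - spaced R D 0ℤ) + + N * z
            ≡⟨ cong₂ (λ w m → Φ + (spaced R D 0ℤ + w * (+ 2 * c + 1ℤ) - spaced R D 0ℤ) + m * z) (sym Z≡) N≡ ⟩
          Φ + (spaced R D 0ℤ + + Z * (+ 2 * c + 1ℤ) - spaced R D 0ℤ) + + 2 * + Z * n * z
            ≡⟨ collect Φ (spaced R D 0ℤ) (+ Z) c n z ⟩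
          Φ + + Z * (+ 2 * (c + n * z) + 1ℤ) ∎
          where
          collect : ∀ f s y c n z → f + (s + y * (+ 2 * c + 1ℤ) - s) + + 2 * y * n * z ≡
                                    f + y * (+ 2 * (c + n * z) + 1ℤ)
          collect = solve-∀

      abstract
        bit-changes : ∀ k → r ≡ 2 ℕ.^ k → ∀ t → t ≢ 0ℤ → ∣ t ∣ ℕ.< r ℕ.^ J →
          ∃[ i ] bit i (a + t) (along t) ≢ bit i a b
        bit-changes = levelBit-changes

-- Pigeonhole principle and numbering of finite families.

module Counting where
  open import Data.List using (List; []; _∷_; length; filter; lookup)
  open import Data.List.Relation.Unary.All as All using (All; []; _∷_)
  import Data.List.Relation.Unary.All.Properties as All
  open import Data.List.Relation.Unary.AllPairs using ([]; _∷_)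
  open import Data.List.Relation.Unary.Unique.Propositional using (Unique)
  import Data.List.Relation.Unary.Unique.Propositional.Properties as Unique
  open import Data.List.Membership.Propositional.Properties using (∈-lookup)
  open ≡ using (refl; sym; trans; cong; cong₂; subst; module ≡-Reasoning)
  open import Relation.Unary using (Decidable)

  length-filter-complement : ∀ {A : Set} {P : A → Set} (P? : Decidable P) xs →
    length xs ≡ length (filter P? xs) ℕ.+ length (filter (¬? ∘ P?) xs)
  length-filter-complement P? []       = refl
  length-filter-complement P? (x ∷ xs) with P? x
  ... | yes _ = cong suc (length-filter-complement P? xs)
  ... | no  _ = trans (cong suc (length-filter-complement P? xs)) (sym (ℕ.+-suc _ _))

  lookup-injective : ∀ {A : Set} {xs : List A} → Unique xs → ∀ i j → lookup xs i ≡ lookup xs j → i ≡ j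
  lookup-injective (x∉ ∷ u) zero    zero    e = refl
  lookup-injective (x∉ ∷ u) zero    (suc j) e = contradiction e (All.lookup x∉ (∈-lookup j))
  lookup-injective (x∉ ∷ u) (suc i) zero    e = contradiction (sym e) (All.lookup x∉ (∈-lookup i))
  lookup-injective (x∉ ∷ u) (suc i) (suc j) e = cong suc (lookup-injective u i j e)

  -- Pigeonhole by induction on the number `n` of colours: the fibre over the last colour is
  -- filtered out, and the remaining elements have smaller colours. Duplicate-free lists stand for
  -- finite sets.
  bounded-fibres : ∀ {A : Set} (f : A → ℕ) m →
    (∀ c ys → Unique ys → All (λ y → f y ≡ c) ys → length ys ℕ.≤ m) →
    ∀ n xs → Unique xs → All (λ x → f x ℕ.< n) xs → length xs ℕ.≤ n ℕ.* m
  bounded-fibres f m fibre zero    []       u a = z≤n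
  bounded-fibres f m fibre zero    (x ∷ xs) u (() ∷ _)
  bounded-fibres f m fibre (suc n) xs       u a =
    subst (ℕ._≤ m ℕ.+ n ℕ.* m) (sym (length-filter-complement P? xs))
      (ℕ.+-mono-≤
        (fibre n (filter P? xs) (Unique.filter⁺ P? u) (All.all-filter P? xs))
        (bounded-fibres f m fibre n (filter (¬? ∘ P?) xs) (Unique.filter⁺ (¬? ∘ P?) u)
          (All.map (λ (fx≢n , fx<) → ℕ.≤∧≢⇒< (ℕ.≤-pred fx<) fx≢n)
            (All.zip (All.all-filter (¬? ∘ P?) xs , All.filter⁺ (¬? ∘ P?) a)))))
    where
    P? = λ x → f x ℕ.≟ n

  funToFin-cong : ∀ {m n} (f g : Fin m → Fin n) → (∀ i → f i ≡ g i) → funToFin f ≡ funToFin g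
  funToFin-cong {zero}  f g e = refl
  funToFin-cong {suc m} f g e = cong₂ combine (e zero) (funToFin-cong (f ∘ suc) (g ∘ suc) (e ∘ suc))

  finToFun-injective : ∀ m n (k l : Fin (n ℕ.^ m)) → (∀ i → finToFun {n} {m} k i ≡ finToFun {n} {m} l i) → k ≡ l
  finToFun-injective m n k l e = trans (sym (Fin.funToFin-finToFin {m} {n} k))
    (trans (funToFin-cong (finToFun {n} {m} k) (finToFun {n} {m} l) e) (Fin.funToFin-finToFin {m} {n} l))

  boolToFin : Bool → Fin 2
  boolToFin false = zero
  boolToFin true  = suc zero

  boolToFin-injective : ∀ {a b} → boolToFin a ≡ boolToFin b → a ≡ b
  boolToFin-injective {false} {false} _ = refl
  boolToFin-injective {true}  {true}  _ = refl

  encode : ∀ {s J} → (Fin s → Fin J → Bool) → Fin (2 ℕ.^ (s ℕ.* J))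
  encode {s} {J} f = funToFin (λ i → let (β , j) = remQuot {s} J i in boolToFin (f β j))

  encode-injective : ∀ {s J} (f g : Fin s → Fin J → Bool) → encode f ≡ encode g → ∀ β j → f β j ≡ g β j
  encode-injective {s} {J} f g e β j = boolToFin-injective (begin
    boolToFin (f β j)                                  ≡⟨ cong (bit f) (sym (Fin.remQuot-combine β j)) ⟩
    bit f (remQuot {s} J (combine β j))                ≡⟨ sym (Fin.finToFun-funToFin (bit f ∘ remQuot {s} J) (combine β j)) ⟩
    finToFun (encode f) (combine β j)                  ≡⟨ cong (λ c → finToFun c (combine β j)) e ⟩
    finToFun (encode g) (combine β j)                  ≡⟨ Fin.finToFun-funToFin (bit g ∘ remQuot {s} J) (combine β j) ⟩
    bit g (remQuot {s} J (combine β j))                ≡⟨ cong (bit g) (Fin.remQuot-combine β j) ⟩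
    boolToFin (g β j)                                  ∎)
    where
    open ≡-Reasoning
    bit : (Fin s → Fin J → Bool) → Fin s × Fin J → Fin 2
    bit f (β , j) = boolToFin (f β j)

  module Box (s d A B : ℕ) where
    size : ℕ
    size = (A ℕ.* B ℕ.^ d) ℕ.^ s

    row : Fin (A ℕ.* B ℕ.^ d) → Fin (suc d) → ℕ
    row k zero    = toℕ (proj₁ (remQuot {A} (B ℕ.^ d) k))
    row k (suc c) = toℕ (finToFun {B} {d} (proj₂ (remQuot {A} (B ℕ.^ d) k)) c)

    row-injective : ∀ k l → (∀ c → row k c ≡ row l c) → k ≡ l
    row-injective k l e = trans (sym (Fin.combine-remQuot {A} (B ℕ.^ d) k))
      (trans (cong₂ combine (Fin.toℕ-injective (e zero))
               (finToFun-injective d B _ _ (λ c → Fin.toℕ-injective (e (suc c)))))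
             (Fin.combine-remQuot {A} (B ℕ.^ d) l))

    element : Fin size → Fin s → Fin (suc d) → ℕ
    element k β = row (finToFun {A ℕ.* B ℕ.^ d} {s} k β)

    element-injective : ∀ k l → (∀ β c → element k β c ≡ element l β c) → k ≡ l
    element-injective k l e = finToFun-injective s (A ℕ.* B ℕ.^ d) k l (λ β →
      row-injective (finToFun {A ℕ.* B ℕ.^ d} {s} k β) (finToFun {A ℕ.* B ℕ.^ d} {s} l β) (e β))

    element-bounds : ∀ k β → element k β zero ℕ.< A × (∀ c → element k β (suc c) ℕ.< B)
    element-bounds k β = Fin.toℕ<n _ , λ c → Fin.toℕ<n _

-- Separating s-tuples of integer vectors in a box, modulo p.

module BoxConfigurations where
  open import Data.Integer using (ℤ; +_; _+_; _*_; _-_; 0ℤ; ∣_∣)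
  open import Data.Integer.Tactic.RingSolver using (solve-∀)
  open ≡ using (refl; sym; trans; cong; cong₂; subst; subst₂; module ≡-Reasoning)
  open IntegerPolynomials
  open LevelColouring
  open ≡-Reasoning

  small-multiple : ∀ {p} z y → z ≡ + p * y → ∣ z ∣ ℕ.< p → z ≡ 0ℤ
  small-multiple {p} z y e z<p = helper ∣ y ∣ refl
    where
    helper : ∀ n → ∣ y ∣ ≡ n → z ≡ 0ℤ
    helper zero    eq = trans e (trans (cong (+ p *_) (ℤ.∣i∣≡0⇒i≡0 eq)) (ℤ.*-zeroʳ (+ p)))
    helper (suc n) eq = contradiction z<p (ℕ.≤⇒≯ (subst (p ℕ.≤_)
      (sym (trans (cong ∣_∣ e) (trans (ℤ.abs-* (+ p) y) (cong (p ℕ.*_) eq)))) (ℕ.m≤m*n p (suc n))))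

  %-≡⇒difference : ∀ m n p .{{_ : NonZero p}} → m % p ≡ n % p → ∃[ z ] + m ≡ + n + + p * z
  %-≡⇒difference m n p e = + (m ℕ./ p) - + (n ℕ./ p) , (begin
    + m                                    ≡⟨ expand m ⟩
    + (m % p) + + (m ℕ./ p) * + p          ≡⟨ cong (λ r → + r + + (m ℕ./ p) * + p) e ⟩
    + (n % p) + + (m ℕ./ p) * + p          ≡⟨ identity (+ (n % p)) (+ (m ℕ./ p)) (+ (n ℕ./ p)) (+ p) ⟩
    (+ (n % p) + + (n ℕ./ p) * + p) + + p * (+ (m ℕ./ p) - + (n ℕ./ p))
      ≡⟨ cong (λ x → x + + p * (+ (m ℕ./ p) - + (n ℕ./ p))) (sym (expand n)) ⟩
    + n + + p * (+ (m ℕ./ p) - + (n ℕ./ p)) ∎)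
    where
    expand : ∀ m → + m ≡ + (m % p) + + (m ℕ./ p) * + p
    expand m = trans (cong +_ (ℕ.m≡m%n+[m/n]*n m p))
      (trans (ℤ.pos-+ (m % p) _) (cong (λ z → + (m % p) + z) (ℤ.pos-* (m ℕ./ p) p)))
    identity : ∀ r x y p → r + x * p ≡ (r + y * p) + p * (x - y)
    identity = solve-∀

  module Configurations (s e D K h g J : ℕ) where
    ρ n d : ℕ
    ρ = 2 ℕ.^ h
    n = s ℕ.* (D ℕ.* (D ℕ.* K))
    d = suc (n ℕ.+ e)

    open Block D K ρ J

    Configuration : Set
    Configuration = Fin s → Fin d → ℕ

    -- All s rows move along the same direction, but each needs a direction adapted to it. Hence the
    -- coordinates form s blocks: row β is coloured through its block β only, and only that block of
    -- the direction is tuned to it. The last `e` coordinates are spare.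
    read : ∀ {A : Set} → Fin s → (Fin d → A) → Coordinates A
    read β y j l κ = y (suc (combine β (combine j (combine l κ)) ↑ˡ e))

    module _ {A : Set} (c : Fin s → Coordinates A) where
      entry₂ : Fin s → Fin D → Fin D × Fin K → A
      entry₂ β j (l , κ) = c β j l κ

      entry₁ : Fin s → Fin D × Fin (D ℕ.* K) → A
      entry₁ β (j , z) = entry₂ β j (remQuot K z)

      entry₀ : Fin s × Fin (D ℕ.* (D ℕ.* K)) → A
      entry₀ (β , y) = entry₁ β (remQuot (D ℕ.* K) y)

      entry : Fin n → A
      entry i = entry₀ (remQuot (D ℕ.* (D ℕ.* K)) i)

      entry-combine : ∀ β j l κ → entry (combine β (combine j (combine l κ))) ≡ c β j l κ
      entry-combine β j l κ = trans (cong entry₀ (Fin.remQuot-combine β (combine j (combine l κ))))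
        (trans (cong (entry₁ β) (Fin.remQuot-combine j (combine l κ)))
          (cong (entry₂ β j) (Fin.remQuot-combine l κ)))

    write : ∀ {A : Set} → A → A → (Fin s → Coordinates A) → Fin d → A
    write a₀ a₁ c zero    = a₀
    write a₀ a₁ c (suc i) = [ entry c , const a₁ ]′ (splitAt n i)

    read-write : ∀ {A : Set} a₀ a₁ (c : Fin s → Coordinates A) β j l κ →
                 read β (write a₀ a₁ c) j l κ ≡ c β j l κ
    read-write a₀ a₁ c β j l κ = trans
      (cong [ entry c , const a₁ ]′ (Fin.splitAt-↑ˡ n (combine β (combine j (combine l κ))) e))
      (entry-combine c β j l κ)

    write-all : ∀ {A : Set} (P : A → Set) a₀ a₁ c → P a₁ → (∀ β j l κ → P (c β j l κ)) →
                ∀ i → P (write a₀ a₁ c (suc i))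
    write-all P a₀ a₁ c p₁ pc i with splitAt n i
    ... | inj₁ i′ = pc _ _ _ _
    ... | inj₂ _  = p₁

    first : Configuration → Fin s → ℤ
    first x β = + x β zero

    rest : Configuration → Fin s → Coordinates ℤ
    rest x β = read β (λ c → + x β c)

    colour : Configuration → Fin s → Fin J → Bool
    colour x β i = bit i (first x β) (rest x β)

    -- First coordinates differ by less than 2ᵍ and the later entries of a direction are below 2ʰ,
    -- so a displacement t w stays within 2^(h + g), the side of the box in the other coordinates.
    Boxed : Configuration → Set
    Boxed x = ∀ β → x β zero ℕ.< 2 ℕ.^ g × (∀ c → x β (suc c) ℕ.< 2 ℕ.^ (h ℕ.+ g))

    module _ (N≤ρ^K : N ℕ.≤ ρ ℕ.^ K) where
      -- The leading 1 makes the parameter visible as the change of the first coordinate; the spare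
      -- coordinates stay fixed.
      direction : Configuration → Fin d → ℕ
      direction x = write 1 0 (λ β → slope N≤ρ^K (first x β) (rest x β))

      direction< : ∀ x i → direction x (suc i) ℕ.< ρ
      direction< x = write-all (ℕ._< ρ) 1 0 _ (ℕ.m^n>0 2 h)
        (λ β → slope< N≤ρ^K (first x β) (rest x β))

      module _ (k : ℕ) (r≡2^k : r ≡ 2 ℕ.^ k) (2^g≤r^J : 2 ℕ.^ g ℕ.≤ r ℕ.^ J)
               (p : ℕ) (2^m≤p : 2 ℕ.^ (suc (h ℕ.+ g)) ℕ.≤ p) where

        -- The parameter `τ β` matters modulo p only, and the integer t = y₀ - x₀ of row β
        -- represents it. For every other coordinate, y - x - t w is then a multiple of p too small
        -- to be nonzero. So row β of `y` arises from that of `x` by moving along w over ℤ, and for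
        -- t ≠ 0 some bit would have changed.
        separated : ∀ x y → Boxed x → Boxed y → (∀ β i → colour x β i ≡ colour y β i) →
          (τ : Fin s → ℕ) →
          (∀ β c → ∃[ z ] + y β c ≡ + (x β c ℕ.+ direction x c ℕ.* τ β) + + p * z) →
          ∀ β c → y β c ≡ x β c
        separated x y x-boxed y-boxed same τ on β = coordinate
          where
          w = direction x
          t = + y β zero - + x β zero

          ∣t∣< : ∣ t ∣ ℕ.< 2 ℕ.^ g
          ∣t∣< = ∣m-n∣<o (ℕ.<-≤-trans (proj₁ (y-boxed β)) (ℕ.m≤n+m _ _))
                         (ℕ.<-≤-trans (proj₁ (x-boxed β)) (ℕ.m≤n+m _ _))

          z₀ = proj₁ (on β zero)

          t≡ : t ≡ + τ β + + p * z₀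
          t≡ = trans (cong (_- + x β zero) (trans (proj₂ (on β zero))
                 (cong (_+ + p * z₀) (trans (cong (λ u → + (x β zero ℕ.+ u)) (ℕ.*-identityˡ (τ β))) (ℤ.pos-+ (x β zero) (τ β))))))
               (cancel (+ x β zero) (+ τ β) (+ p * z₀))
            where
            cancel : ∀ a b c → a + b + c - a ≡ b + c
            cancel = solve-∀

          lifted : ∀ c → + y β (suc c) - + x β (suc c) - t * + w (suc c) ≡ 0ℤ
          lifted c = small-multiple _ (z - z₀ * + w (suc c)) multiple small
            where
            z = proj₁ (on β (suc c))
            multiple : + y β (suc c) - + x β (suc c) - t * + w (suc c) ≡ + p * (z - z₀ * + w (suc c))
            multiple = trans (cong₂ (λ Y T → Y - + x β (suc c) - T * + w (suc c))
              (trans (proj₂ (on β (suc c))) (cong (_+ + p * z)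
                (trans (ℤ.pos-+ (x β (suc c)) _) (cong (λ u → + x β (suc c) + u) (ℤ.pos-* (w (suc c)) (τ β)))))) t≡)
              (identity (+ x β (suc c)) (+ w (suc c)) (+ τ β) (+ p) z z₀)
              where
              identity : ∀ x w τ p z z₀ → x + w * τ + p * z - x - (τ + p * z₀) * w ≡ p * (z - z₀ * w)
              identity = solve-∀
            U = 2 ℕ.^ (h ℕ.+ g)
            tw< : ∣ t * + w (suc c) ∣ ℕ.≤ U
            tw< = subst₂ ℕ._≤_ (sym (ℤ.abs-* t (+ w (suc c))))
              (trans (ℕ.*-comm (2 ℕ.^ g) ρ) (sym (ℕ.^-distribˡ-+-* 2 h g)))
              (ℕ.*-mono-≤ (ℕ.<⇒≤ ∣t∣<) (ℕ.<⇒≤ (direction< x c)))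
            -- The two box entries contribute less than U and t w at most U, and 2U = 2^(h + g + 1)
            -- ≤ p.
            small : ∣ + y β (suc c) - + x β (suc c) - t * + w (suc c) ∣ ℕ.< p
            small = ℕ.<-≤-trans (ℕ.≤-<-trans (ℤ.∣i-j∣≤∣i∣+∣j∣ (+ y β (suc c) - + x β (suc c)) (t * + w (suc c)))
              (subst (∣ + y β (suc c) - + x β (suc c) ∣ ℕ.+ ∣ t * + w (suc c) ∣ ℕ.<_) (cong (U ℕ.+_) (sym (ℕ.+-identityʳ U)))
                (ℕ.+-mono-<-≤ (∣m-n∣<o (ℕ.<-≤-trans (proj₂ (y-boxed β) c) (ℕ.m≤n+m _ _))
                                       (ℕ.<-≤-trans (proj₂ (x-boxed β) c) (ℕ.m≤n+m _ _))) tw<)))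
              2^m≤p

          exact : ∀ c → + y β (suc c) ≡ + x β (suc c) + t * + w (suc c)
          exact c = trans (isolate (+ y β (suc c)) (+ x β (suc c)) (t * + w (suc c)))
            (trans (cong (λ u → u + + x β (suc c) + t * + w (suc c)) (lifted c)) (cong (_+ t * + w (suc c)) (ℤ.+-identityˡ (+ x β (suc c)))))
            where
            isolate : ∀ y x u → y ≡ y - x - u + x + u
            isolate = solve-∀

          first-moves : + x β zero + t ≡ + y β zero
          first-moves = cancel (+ x β zero) (+ y β zero)
            where
            cancel : ∀ a b → a + (b - a) ≡ b
            cancel = solve-∀

          t≡0 : t ≡ 0ℤ
          t≡0 with t ℤ.≟ 0ℤ
          ... | yes e = e
          ... | no t≢0 with bit-changes N≤ρ^K (first x β) (rest x β) k r≡2^k t t≢0 (ℕ.<-≤-trans ∣t∣< 2^g≤r^J)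
          ... | i , changed = contradiction (trans (bit-cong i first-moves rest-moves) (sym (same β i))) changed
            where
            rest-moves : ∀ j l κ → along N≤ρ^K (first x β) (rest x β) t j l κ ≡ rest y β j l κ
            rest-moves j l κ = sym (trans (exact _)
              (cong (λ u → rest x β j l κ + t * + u) (read-write 1 0 (λ β → slope N≤ρ^K (first x β) (rest x β)) β j l κ)))

          coordinate : ∀ c → y β c ≡ x β c
          coordinate zero    = ℤ.+-injective (trans (sym first-moves) (trans (cong (λ u → + x β zero + u) t≡0) (ℤ.+-identityʳ _)))
          coordinate (suc c) = ℤ.+-injective (trans (exact c) (trans (cong (λ u → + x β (suc c) + u * + w (suc c)) t≡0) (ℤ.+-identityʳ _)))

-- A basis of the finite field over its prime field.

module FieldBasis where
  import Data.Fin.Permutation as Perm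
  open import Data.Nat.Coprimality using (prime⇒coprime; coprime-Bézout)
  open import Data.Nat.GCD using (module Bézout)
  open import Data.Vec.Functional using (Vector; _∷_; tail)
  open import Relation.Binary.Definitions using (tri<; tri≈; tri>)
  open Counting

  module PrimePowerField {q : ℕ} (F : FiniteField q) where
    open FiniteField F hiding (zero)
    open Inverse enumeration using (to; from; to-cong; strictlyInverseʳ; strictlyInverseˡ)
    open import Algebra.Properties.CommutativeMonoid.Mult +-commutativeMonoid
      using () renaming (_×_ to _·_; ×-congʳ to ·-congʳ; ×-congˡ to ·-congˡ; ×-homo-+ to ·-homo-+;
                         ×-assocˡ to ·-assocˡ; ×-distrib-+ to ·-distrib-+)
    open import Algebra.Properties.Semiring.Mult semiring using (×1-homo-*; ×-assoc-*)
    open import Algebra.Properties.CommutativeMonoid.Sum +-commutativeMonoid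
      using (sum; sum-cong-≋; ∑-distrib-+; sum-permute; sum-replicate)
    open import Algebra.Properties.Group +-group using () renaming (∙-cancelˡ to +-cancelˡ; identityʳ-unique to +-identityʳ-unique)
    open import Relation.Binary.Reasoning.Setoid setoid

    to-injective : ∀ {x y} → to x ≡ to y → x ≈ y
    to-injective {x} {y} e = trans (sym (strictlyInverseʳ x))
      (trans (reflexive (≡.cong from e)) (strictlyInverseʳ y))

    _≈?_ : ∀ x y → Dec (x ≈ y)
    x ≈? y = map′ to-injective to-cong (to x Fin.≟ to y)

    ·-* : ∀ n x → n · x ≈ (n · 1#) * x
    ·-* n x = sym (trans (×-assoc-* n 1# x) (·-congʳ n (*-identityˡ x)))

    -- Translation by 1 permutes the field, so adding 1 to every element does not change their sum.
    q·1≈0 : q · 1# ≈ 0#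
    q·1≈0 = +-identityʳ-unique (sum from) (q · 1#) (sym (begin
      sum from                               ≈⟨ sum-permute from shift ⟩
      sum (λ i → from (to (from i + 1#)))    ≈⟨ sum-cong-≋ (λ i → strictlyInverseʳ (from i + 1#)) ⟩
      sum (λ i → from i + 1#)                ≈⟨ ∑-distrib-+ from (const 1#) ⟩
      sum from + sum (const {B = Fin q} 1#)  ≈⟨ +-congˡ (sum-replicate q) ⟩
      sum from + q · 1#                      ∎))
      where
      shift : Perm.Permutation q q
      shift = Perm.permutation (λ i → to (from i + 1#)) (λ i → to (from i + - 1#))
        (λ i → ≡.trans (to-cong (trans (+-congʳ (strictlyInverseʳ _))
                 (trans (+-assoc _ _ _) (trans (+-congˡ (-‿inverseˡ 1#)) (+-identityʳ _)))))
                 (strictlyInverseˡ i))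
        (λ i → ≡.trans (to-cong (trans (+-congʳ (strictlyInverseʳ _))
                 (trans (+-assoc _ _ _) (trans (+-congˡ (-‿inverseʳ 1#)) (+-identityʳ _)))))
                 (strictlyInverseˡ i))

    -- Natural numbers stand for the scalars of the prime field; by `comb-%` below only their
    -- residues modulo p matter.
    comb : ∀ {n} → Vector ℕ n → Vector Carrier n → Carrier
    comb c e = sum (λ i → c i · e i)

    comb-+ : ∀ {n} (a b : Vector ℕ n) e → comb (λ i → a i ℕ.+ b i) e ≈ comb a e + comb b e
    comb-+ a b e = trans (sum-cong-≋ (λ i → ·-homo-+ (e i) (a i) (b i)))
                         (∑-distrib-+ (λ i → a i · e i) (λ i → b i · e i))

    comb-* : ∀ {n} m (c : Vector ℕ n) e → comb (λ i → m ℕ.* c i) e ≈ m · comb c e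
    comb-* {zero}  zero    c e = refl
    comb-* {zero}  (suc m) c e = trans (comb-* m c e) (sym (+-identityˡ _))
    comb-* {suc n} m c e = trans (+-cong (sym (·-assocˡ (e zero) m (c zero))) (comb-* m (tail c) (tail e)))
      (sym (·-distrib-+ (c zero · e zero) (comb (tail c) (tail e)) m))

    comb-cong : ∀ {n} {a b : Vector ℕ n} → (∀ i → a i ≡ b i) → ∀ e → comb a e ≈ comb b e
    comb-cong a≡b e = sum-cong-≋ (λ i → ·-congˡ (a≡b i))

    module Characteristic (p s : ℕ) (p-prime : Prime p) (q≡p^s : q ≡ p ℕ.^ s) where
      instance
        p≢0 : NonZero p
        p≢0 = prime⇒nonZero p-prime
        _ = prime⇒nonTrivial p-prime

      -- Unless p · 1 is zero it is invertible, so a factor p can be cancelled from pⁿ · 1 = 0.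
      -- Repeating this would end in 1 = 0.
      power-zero : ∀ n → (p ℕ.^ n) · 1# ≈ 0# → p · 1# ≈ 0#
      power-zero zero    e = contradiction (trans (sym (+-identityʳ 1#)) e) 1≉0
      power-zero (suc n) e with (p · 1#) ≈? 0#
      ... | yes p≈0 = p≈0
      ... | no  p≉0 with inverse (p · 1#) p≉0
      ... | y , py≈1 = power-zero n (begin
        (p ℕ.^ n) · 1#                          ≈⟨ *-identityˡ _ ⟨
        1# * ((p ℕ.^ n) · 1#)                   ≈⟨ *-congʳ (trans (*-comm y (p · 1#)) py≈1) ⟨
        y * (p · 1#) * ((p ℕ.^ n) · 1#)         ≈⟨ *-assoc _ _ _ ⟩
        y * ((p · 1#) * ((p ℕ.^ n) · 1#))       ≈⟨ *-congˡ (×1-homo-* p (p ℕ.^ n)) ⟨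
        y * ((p ℕ.* p ℕ.^ n) · 1#)              ≈⟨ *-congˡ e ⟩
        y * 0#                                  ≈⟨ zeroʳ y ⟩
        0#                                      ∎)

      p·x≈0 : ∀ x → p · x ≈ 0#
      p·x≈0 x = trans (·-* p x) (trans (*-congʳ (power-zero s
        (≡.subst (λ n → n · 1# ≈ 0#) q≡p^s q·1≈0))) (zeroˡ x))

      ·-% : ∀ n x → n · x ≈ (n % p) · x
      ·-% n x = begin
        n · x                                  ≈⟨ ·-congˡ (ℕ.m≡m%n+[m/n]*n n p) ⟩
        (n % p ℕ.+ n ℕ./ p ℕ.* p) · x          ≈⟨ ·-homo-+ x (n % p) (n ℕ./ p ℕ.* p) ⟩
        (n % p) · x + (n ℕ./ p ℕ.* p) · x      ≈⟨ +-congˡ (begin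
          (n ℕ./ p ℕ.* p) · x                    ≈⟨ ·-congˡ (ℕ.*-comm (n ℕ./ p) p) ⟩
          (p ℕ.* (n ℕ./ p)) · x                  ≈⟨ ·-assocˡ x p (n ℕ./ p) ⟨
          p · ((n ℕ./ p) · x)                    ≈⟨ p·x≈0 _ ⟩
          0#                                     ∎) ⟩
        (n % p) · x + 0#                       ≈⟨ +-identityʳ _ ⟩
        (n % p) · x                            ∎

      comb-% : ∀ {n} (c : Vector ℕ n) e → comb c e ≈ comb (λ i → c i % p) e
      comb-% c e = sum-cong-≋ (λ i → ·-% (c i) (e i))

      Spanned : ∀ {n} → Vector Carrier n → Carrier → Set
      Spanned e x = ∃[ c ] x ≈ comb c e

      -- Uniqueness of coefficients modulo p expresses linear independence without subtracting
      -- natural numbers.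
      Independent : ∀ {n} → Vector Carrier n → Set
      Independent e = ∀ c c′ → comb c e ≈ comb c′ e → ∀ i → c i % p ≡ c′ i % p

      -- Subtracting `comb a e` amounts to adding it p - 1 times.
      spanned-difference : ∀ {n} (e : Vector Carrier n) v a b → v + comb a e ≈ comb b e → Spanned e v
      spanned-difference e v a b eq = (λ i → b i ℕ.+ ℕ.pred p ℕ.* a i) , (begin
        v                                       ≈⟨ +-identityʳ v ⟨
        v + 0#                                  ≈⟨ +-congˡ (p·x≈0 (comb a e)) ⟨
        v + p · comb a e                        ≈⟨ +-congˡ (·-congˡ (≡.sym (ℕ.suc-pred p))) ⟩
        v + (comb a e + ℕ.pred p · comb a e)    ≈⟨ +-assoc _ _ _ ⟨
        v + comb a e + ℕ.pred p · comb a e      ≈⟨ +-cong eq (sym (comb-* (ℕ.pred p) a e)) ⟩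
        comb b e + comb (λ i → ℕ.pred p ℕ.* a i) e ≈⟨ comb-+ b _ e ⟨
        comb (λ i → b i ℕ.+ ℕ.pred p ℕ.* a i) e ∎)

      multiply : ∀ {n} (e : Vector Carrier n) v y a X →
        (y ℕ.* a) · v + comb (λ i → y ℕ.* X i) e ≈ y · (a · v + comb X e)
      multiply e v y a X = trans (+-cong (sym (·-assocˡ v y a)) (comb-* y X e)) (sym (·-distrib-+ _ _ y))

      -- The equation says that (b - a) v is spanned, and 0 < b - a < p makes b - a invertible
      -- modulo p. Multiplying both sides by a Bézout coefficient y takes the place of dividing.
      spanned-multiple : ∀ {n} (e : Vector Carrier n) v a b (X Y : Vector ℕ n) → a ℕ.< b → b ℕ.< p →
        a · v + comb X e ≈ b · v + comb Y e → Spanned e v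
      spanned-multiple e v a b X Y a<b b<p eq
        with coprime-Bézout (prime⇒coprime p-prime {{ℕ.>-nonZero (ℕ.m<n⇒0<n∸m a<b)}}
                               (ℕ.≤-<-trans (ℕ.m∸n≤m b a) b<p))
      -- Here y (b - a) = 1 + x p, so (y a + 1) v and y b v agree.
      ... | Bézout.-+ x y bz = spanned-difference e v (λ i → y ℕ.* Y i) (λ i → y ℕ.* X i)
        (+-cancelˡ ((y ℕ.* a) · v) _ _ (begin
          (y ℕ.* a) · v + (v + comb (λ i → y ℕ.* Y i) e)     ≈⟨ +-assoc _ _ _ ⟨
          (y ℕ.* a) · v + v + comb (λ i → y ℕ.* Y i) e       ≈⟨ +-congʳ step ⟩
          (y ℕ.* b) · v + comb (λ i → y ℕ.* Y i) e           ≈⟨ multiply e v y b Y ⟩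
          y · (b · v + comb Y e)                             ≈⟨ ·-congʳ y eq ⟨
          y · (a · v + comb X e)                             ≈⟨ multiply e v y a X ⟨
          (y ℕ.* a) · v + comb (λ i → y ℕ.* X i) e           ∎))
        where
        sum-eq : y ℕ.* b ≡ y ℕ.* a ℕ.+ 1 ℕ.+ x ℕ.* p
        sum-eq = ≡.trans (≡.cong (y ℕ.*_) (≡.sym (ℕ.m+[n∸m]≡n (ℕ.<⇒≤ a<b))))
          (≡.trans (ℕ.*-distribˡ-+ y a (b ℕ.∸ a))
          (≡.trans (≡.cong (y ℕ.* a ℕ.+_) (≡.sym bz)) (≡.sym (ℕ.+-assoc (y ℕ.* a) 1 (x ℕ.* p)))))
        step : (y ℕ.* a) · v + v ≈ (y ℕ.* b) · v
        step = sym (begin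
          (y ℕ.* b) · v                                 ≈⟨ ·-congˡ sum-eq ⟩
          (y ℕ.* a ℕ.+ 1 ℕ.+ x ℕ.* p) · v               ≈⟨ ·-homo-+ v (y ℕ.* a ℕ.+ 1) (x ℕ.* p) ⟩
          (y ℕ.* a ℕ.+ 1) · v + (x ℕ.* p) · v           ≈⟨ +-cong (·-homo-+ v (y ℕ.* a) 1) (multiple x v) ⟩
          (y ℕ.* a) · v + (v + 0#) + 0#                 ≈⟨ +-identityʳ _ ⟩
          (y ℕ.* a) · v + (v + 0#)                      ≈⟨ +-congˡ (+-identityʳ v) ⟩
          (y ℕ.* a) · v + v                             ∎)
          where
          multiple : ∀ x v → (x ℕ.* p) · v ≈ 0#
          multiple x v = trans (·-congˡ (ℕ.*-comm x p)) (trans (sym (·-assocˡ v p x)) (p·x≈0 _))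
      -- Here 1 + y (b - a) = x p: y is minus an inverse of b - a, and a and b trade places.
      ... | Bézout.+- x y bz = spanned-difference e v (λ i → y ℕ.* X i) (λ i → y ℕ.* Y i)
        (+-cancelˡ ((y ℕ.* b) · v) _ _ (begin
          (y ℕ.* b) · v + (v + comb (λ i → y ℕ.* X i) e)     ≈⟨ +-assoc _ _ _ ⟨
          (y ℕ.* b) · v + v + comb (λ i → y ℕ.* X i) e       ≈⟨ +-congʳ step ⟩
          (y ℕ.* a) · v + comb (λ i → y ℕ.* X i) e           ≈⟨ multiply e v y a X ⟩
          y · (a · v + comb X e)                             ≈⟨ ·-congʳ y eq ⟩
          y · (b · v + comb Y e)                             ≈⟨ multiply e v y b Y ⟨
          (y ℕ.* b) · v + comb (λ i → y ℕ.* Y i) e           ∎))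
        where
        sum-eq : y ℕ.* b ℕ.+ 1 ≡ y ℕ.* a ℕ.+ x ℕ.* p
        sum-eq = ≡.trans (≡.cong (λ z → y ℕ.* z ℕ.+ 1) (≡.sym (ℕ.m+[n∸m]≡n (ℕ.<⇒≤ a<b))))
          (≡.trans (≡.cong (ℕ._+ 1) (ℕ.*-distribˡ-+ y a (b ℕ.∸ a)))
          (≡.trans (ℕ.+-assoc (y ℕ.* a) _ 1) (≡.cong (y ℕ.* a ℕ.+_) (≡.trans (ℕ.+-comm _ 1) bz))))
        step : (y ℕ.* b) · v + v ≈ (y ℕ.* a) · v
        step = begin
          (y ℕ.* b) · v + v                             ≈⟨ +-congˡ (+-identityʳ v) ⟨
          (y ℕ.* b) · v + 1 · v                         ≈⟨ ·-homo-+ v (y ℕ.* b) 1 ⟨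
          (y ℕ.* b ℕ.+ 1) · v                           ≈⟨ ·-congˡ sum-eq ⟩
          (y ℕ.* a ℕ.+ x ℕ.* p) · v                     ≈⟨ ·-homo-+ v (y ℕ.* a) (x ℕ.* p) ⟩
          (y ℕ.* a) · v + (x ℕ.* p) · v                 ≈⟨ +-congˡ (trans (·-congˡ (ℕ.*-comm x p)) (trans (sym (·-assocˡ v p x)) (p·x≈0 _))) ⟩
          (y ℕ.* a) · v + 0#                            ≈⟨ +-identityʳ _ ⟩
          (y ℕ.* a) · v                                 ∎

      -- If the coefficients of `v` differed modulo p, `spanned-multiple` would put `v` into the
      -- span. Once they agree, the terms in `v` cancel and independence of `e` applies.
      extend : ∀ {n} (e : Vector Carrier n) v → Independent e → ¬ Spanned e v → Independent (v ∷ e)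
      extend e v indep v∉ c c′ eq = λ where
          zero    → heads
          (suc i) → indep (tail c) (tail c′) tails i
        where
        reduced : (c zero % p) · v + comb (tail c) e ≈ (c′ zero % p) · v + comb (tail c′) e
        reduced = trans (+-congʳ (sym (·-% (c zero) v))) (trans eq (+-congʳ (·-% (c′ zero) v)))
        heads : c zero % p ≡ c′ zero % p
        heads with ℕ.<-cmp (c zero % p) (c′ zero % p)
        ... | tri< l _ _ = contradiction (spanned-multiple e v _ _ (tail c) (tail c′) l (ℕ.m%n<n (c′ zero) p) reduced) v∉
        ... | tri≈ _ h _ = h
        ... | tri> _ _ g = contradiction (spanned-multiple e v _ _ (tail c′) (tail c) g (ℕ.m%n<n (c zero) p) (sym reduced)) v∉
        tails : comb (tail c) e ≈ comb (tail c′) e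
        tails = +-cancelˡ ((c zero % p) · v) _ _ (trans reduced (+-congʳ (·-congˡ (≡.sym heads))))

      independent⇒≤ : ∀ {n} (e : Vector Carrier n) → Independent e → p ℕ.^ n ℕ.≤ q
      independent⇒≤ {n} e indep = Fin.injective⇒≤ {f = code} code-injective
        where
        digit : Fin (p ℕ.^ n) → Vector ℕ n
        digit k i = toℕ (finToFun {p} {n} k i)
        code : Fin (p ℕ.^ n) → Fin q
        code k = to (comb (digit k) e)
        digit-% : ∀ k i → digit k i % p ≡ digit k i
        digit-% k i = ℕ.m<n⇒m%n≡m (Fin.toℕ<n (finToFun {p} {n} k i))
        code-injective : ∀ {k l} → code k ≡ code l → k ≡ l
        code-injective {k} {l} eq = ≡.trans (≡.sym (Fin.funToFin-finToFin {n} {p} k))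
          (≡.trans (funToFin-cong _ _ (λ i → Fin.toℕ-injective
            (≡.trans (≡.sym (digit-% k i))
            (≡.trans (indep (digit k) (digit l) (to-injective eq) i) (digit-% l i)))))
          (Fin.funToFin-finToFin {n} {p} l))

      spanning⇒≥ : ∀ {n} (e : Vector Carrier n) → (∀ x → Spanned e x) → q ℕ.≤ p ℕ.^ n
      spanning⇒≥ {n} e spans = Fin.injective⇒≤ {f = code} code-injective
        where
        coordinate : Fin q → Fin n → Fin p
        coordinate k i = fromℕ< (ℕ.m%n<n (proj₁ (spans (from k)) i) p)
        code : Fin q → Fin (p ℕ.^ n)
        code k = funToFin (coordinate k)
        recover : ∀ k → from k ≈ comb (λ i → toℕ (finToFun {p} {n} (code k) i)) e
        recover k = trans (proj₂ (spans (from k))) (trans (comb-% (proj₁ (spans (from k))) e)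
          (comb-cong (λ i → ≡.sym (≡.trans (≡.cong toℕ (Fin.finToFun-funToFin (coordinate k) i))
                                    (Fin.toℕ-fromℕ< _))) e))
        code-injective : ∀ {k l} → code k ≡ code l → k ≡ l
        code-injective {k} {l} eq = ≡.trans (≡.sym (strictlyInverseˡ k)) (≡.trans (to-cong
          (trans (recover k) (trans (comb-cong (λ i → ≡.cong (λ c → toℕ (finToFun {p} {n} c i)) eq) e)
            (sym (recover l))))) (strictlyInverseˡ l))

      spanned? : ∀ {n} (e : Vector Carrier n) x → Dec (Spanned e x)
      spanned? {n} e x = map′
        (λ (k , eq) → (λ i → toℕ (finToFun {p} {n} k i)) , eq)
        (λ (c , eq) → let f = λ i → fromℕ< (ℕ.m%n<n (c i) p) in funToFin f ,
           trans eq (trans (comb-% c e) (comb-cong (λ i → ≡.sym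
             (≡.trans (≡.cong toℕ (Fin.finToFun-funToFin f i)) (Fin.toℕ-fromℕ< _))) e)))
        (Fin.any? {n = p ℕ.^ n} (λ k → x ≈? comb (λ i → toℕ (finToFun {p} {n} k i)) e))

      record Basis (n : ℕ) : Set where
        field
          vectors     : Vector Carrier n
          spans       : ∀ x → Spanned vectors x
          independent : Independent vectors

      n<p^n : ∀ n → n ℕ.< p ℕ.^ n
      n<p^n zero    = ℕ.z<s
      n<p^n (suc n) = ℕ.≤-<-trans (n<p^n n) (ℕ.^-monoʳ-< p (ℕ.nonTrivial⇒n>1 p) (ℕ.n<1+n n))

      -- Elements outside the span are added until none is left. The fuel suffices: n independent
      -- vectors force n < pⁿ ≤ q, whereas running out would mean n = q + 1.
      grow : ∀ fuel {n} → n ℕ.+ fuel ≡ suc q → (e : Vector Carrier n) → Independent e → ∃ Basis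
      grow zero {n} n≡ e indep = contradiction (independent⇒≤ e indep)
        (ℕ.<⇒≱ (ℕ.<-trans (ℕ.≤-reflexive (≡.trans (≡.sym n≡) (ℕ.+-identityʳ n))) (n<p^n n)))
      grow (suc fuel) {n} n≡ e indep with Fin.all? (λ k → spanned? e (from k))
      ... | yes all = n , record
        { vectors = e
        ; spans = λ x → let (c , eq) = all (to x) in c , trans (sym (strictlyInverseʳ x)) eq
        ; independent = indep
        }
      ... | no ¬all with Fin.¬∀⟶∃¬ q _ (λ k → spanned? e (from k)) ¬all
      ... | k , v∉ = grow fuel (≡.trans (≡.sym (ℕ.+-suc n fuel)) n≡) (from k ∷ e) (extend e (from k) indep v∉)

      -- Starting from the empty family, `grow` reaches a basis of some size n; counting
      -- combinations gives pⁿ = q = pˢ, hence n = s.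
      basis : Basis s
      basis with grow (suc q) {0} ≡.refl (λ ()) (λ _ _ _ ())
      ... | n , B = ≡.subst Basis (exponent≡ (≡.trans p^n≡q q≡p^s)) B
        where
        open Basis B
        p^n≡q : p ℕ.^ n ≡ q
        p^n≡q = ℕ.≤-antisym (independent⇒≤ vectors independent) (spanning⇒≥ vectors spans)
        exponent≡ : p ℕ.^ n ≡ p ℕ.^ s → n ≡ s
        exponent≡ e with ℕ.<-cmp n s
        ... | tri< l _ _ = contradiction e (ℕ.<⇒≢ (ℕ.^-monoʳ-< p (ℕ.nonTrivial⇒n>1 p) l))
        ... | tri≈ _ h _ = h
        ... | tri> _ _ g = contradiction (≡.sym e) (ℕ.<⇒≢ (ℕ.^-monoʳ-< p (ℕ.nonTrivial⇒n>1 p) g))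

-- Induced matchings from colour classes.

module Matchings where
  open import Data.Integer using (+_)
  open import Data.List using (List; length; lookup; allFin)
  open import Data.List.Properties using (length-tabulate)
  open import Data.List.Relation.Unary.All as All using (All)
  open import Data.List.Relation.Unary.Unique.Propositional using (Unique)
  import Data.List.Relation.Unary.Unique.Propositional.Properties as Unique
  open import Data.List.Membership.Propositional.Properties using (∈-lookup)
  open import Data.Vec.Functional using (Vector)
  open LevelColouring using (module Block)
  open BoxConfigurations using (module Configurations; %-≡⇒difference)
  open Counting
  open FieldBasis

  module _ {q : ℕ} (F : FiniteField q) (d : ℕ) where
    open FiniteField F using (Carrier; _≈_; 0#; 1#; _+_; _*_; zeroˡ; +-identityʳ; trans; sym; +-congˡ; refl)
    open Incidence F d

    matching-≤-IM : ∀ {m} → InducedMatching m → m ℕ.≤ IM F d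
    matching-≤-IM {m} = proj₂ (proj₂ (IM-exists F d)) m

    -- Every line is based at its own point, so matched pairs are incident at parameter 0 and it
    -- remains to keep distinct pairs apart.
    inducedMatching : ∀ {m} (x v : Fin m → Point) → (∀ i → ¬ (∀ k → v i k ≈ 0#)) →
      (∀ i j → OnLine (x j) (v j) (x i) → i ≡ j) → InducedMatching m
    inducedMatching x v nz separated = record
      { point    = x
      ; line     = λ j → record { base = x j ; direction = v j ; nonzero = nz j }
      ; incident = λ i j → mk⇔ (separated i j) λ where
          ≡.refl → 0# , λ k → sym (trans (+-congˡ (zeroˡ (v i k))) (+-identityʳ (x i k)))
      }

  1≤IM : ∀ {q} (F : FiniteField q) d → 1 ℕ.≤ IM F (suc d)
  1≤IM F d = matching-≤-IM F (suc d) (inducedMatching F (suc d) {1} (λ _ _ → 0#) (λ _ _ → 1#)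
    (λ _ z → 1≉0 (z zero)) λ { zero zero _ → ≡.refl })
    where open FiniteField F hiding (zero)

  -- The hyperplane x₀ = 0 together with the lines in direction (1, 0, …, 0).
  hyperplane-≤-IM : ∀ {q} (F : FiniteField q) d → q ℕ.^ d ℕ.≤ IM F (suc d)
  hyperplane-≤-IM {q} F d = matching-≤-IM F (suc d) (inducedMatching F (suc d) point (const direction)
    (λ _ z → 1≉0 (z zero)) separated)
    where
    open FiniteField F hiding (zero)
    open Inverse enumeration using (to; from; to-cong; strictlyInverseˡ)
    point : Fin (q ℕ.^ d) → Vector Carrier (suc d)
    point k zero    = 0#
    point k (suc i) = from (finToFun {q} {d} k i)
    direction : Vector Carrier (suc d)
    direction zero    = 1#
    direction (suc i) = 0#
    separated : ∀ i j → Incidence.OnLine F (suc d) (point j) direction (point i) → i ≡ j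
    separated i j (t , on) = finToFun-injective d q i j (λ c →
      ≡.trans (≡.sym (strictlyInverseˡ _)) (≡.trans
        (to-cong (trans (on (suc c)) (trans (+-congˡ (zeroʳ t)) (+-identityʳ _)))) (strictlyInverseˡ _)))

  module Construction {q : ℕ} (F : FiniteField q) (p s : ℕ) (p-prime : Prime p) (q≡p^s : q ≡ p ℕ.^ s)
    (e D K h g J : ℕ)
    (N≤ : Block.N D K (2 ℕ.^ h) J ℕ.≤ (2 ℕ.^ h) ℕ.^ K)
    (k : ℕ) (r≡2^k : suc D ≡ 2 ℕ.^ k) (2^g≤r^J : 2 ℕ.^ g ℕ.≤ suc D ℕ.^ J)
    (2^m≤p : 2 ℕ.^ suc (h ℕ.+ g) ℕ.≤ p) where

    open FiniteField F hiding (zero)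
    open PrimePowerField F
    open Characteristic p s p-prime q≡p^s
    open Basis basis
    open Configurations s e D K h g J
    open Box s (n ℕ.+ e) (2 ℕ.^ g) (2 ℕ.^ (h ℕ.+ g))
    open import Algebra.Properties.CommutativeMonoid.Mult +-commutativeMonoid
      using () renaming (_×_ to _·_; ×-congʳ to ·-congʳ; ×-homo-1 to ·-homo-1)
    open import Algebra.Properties.Semiring.Mult semiring using (×-comm-*)
    open Incidence F d using (Point; OnLine)

    embed : Configuration → Point
    embed x c = comb (λ β → x β c) vectors

    embedDirection : Configuration → Point
    embedDirection x c = direction N≤ x c · 1#

    -- Directions have entries in the prime field, so multiplication by `t` acts on the basis
    -- coordinates separately: row β moves along the common integer direction with the β-th
    -- coordinate of `t` as its parameter.
    scaled : ∀ t n → t * (n · 1#) ≈ comb (λ β → n ℕ.* proj₁ (spans t) β) vectors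
    scaled t n = trans (×-comm-* n t 1#) (trans (·-congʳ n (trans (*-identityʳ t) (proj₂ (spans t))))
                   (sym (comb-* n (proj₁ (spans t)) vectors)))

    on-line⇒congruent : ∀ x y t → (∀ c → embed y c ≈ embed x c + t * embedDirection x c) →
      ∀ β c → ∃[ z ] + y β c ≡ + (x β c ℕ.+ direction N≤ x c ℕ.* proj₁ (spans t) β) ℤ.+ + p ℤ.* z
    on-line⇒congruent x y t on β c = %-≡⇒difference _ _ p
      (independent (λ β → y β c) (λ β → x β c ℕ.+ direction N≤ x c ℕ.* proj₁ (spans t) β)
        (trans (on c) (trans (+-congˡ (scaled t (direction N≤ x c)))
          (sym (comb-+ (λ β → x β c) (λ β → direction N≤ x c ℕ.* proj₁ (spans t) β) vectors)))) β)

    class : Fin size → ℕ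
    class i = toℕ (encode (colour (element i)))

    -- If the point of one member lies on the line of another, independence of the basis turns this
    -- into congruences modulo p for each row and coordinate. All bits agree within the class, so
    -- `separated` identifies the two members.
    class-matching : ∀ c is → Unique is → All (λ i → class i ≡ c) is → length is ℕ.≤ IM F d
    class-matching c is unique same = matching-≤-IM F d (inducedMatching F d
      (embed ∘ x) (embedDirection ∘ x)
      (λ i z → 1≉0 (trans (sym (·-homo-1 1#)) (z zero)))
      λ i j (t , on) → lookup-injective unique i j (element-injective _ _
        (separated N≤ k r≡2^k 2^g≤r^J p 2^m≤p (x j) (x i) (boxed (lookup is j)) (boxed (lookup is i))
          (encode-injective (colour (x j)) (colour (x i)) (Fin.toℕ-injective
            (≡.trans (All.lookup same (∈-lookup j)) (≡.sym (All.lookup same (∈-lookup i))))))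
          (proj₁ (spans t)) (on-line⇒congruent (x j) (x i) t on))))
      where
      x : Fin (length is) → Configuration
      x i = element (lookup is i)
      boxed : ∀ i → Boxed (element i)
      boxed i β = element-bounds i β

    size-≤ : size ℕ.≤ 2 ℕ.^ (s ℕ.* J) ℕ.* IM F d
    size-≤ = ≡.subst (ℕ._≤ 2 ℕ.^ (s ℕ.* J) ℕ.* IM F d) (length-tabulate {n = size} id)
      (bounded-fibres class (IM F d) class-matching (2 ℕ.^ (s ℕ.* J)) (allFin size)
        (Unique.allFin⁺ size) (All.universal (λ i → Fin.toℕ<n (encode (colour (element i)))) _))

-- Choice of parameters and the bound in natural numbers.

module LowerBound where
  open import Data.Nat as ℕ
  open import Data.Nat.Properties
  open import Data.Nat.DivMod using (m≡m%n+[m/n]*n; m%n<n; m/n*n≤m)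
  open import Data.Nat.Tactic.RingSolver using (solve-∀)
  open ≡ using (refl; sym; trans; cong; cong₂; subst)
  open LevelColouring using (module Block; *-^)
  open Matchings

  binaryLog : ∀ n → ∃[ m ] 2 ^ m ≤ suc n × suc n < 2 ^ suc m
  binaryLog zero    = 0 , ≤-refl , ≤-refl
  binaryLog (suc n) with binaryLog n
  ... | m , lower , upper with suc (suc n) <? 2 ^ suc m
  ... | yes below = m , m≤n⇒m≤1+n lower , below
  ... | no  above = suc m , ≮⇒≥ above , ≤-<-trans upper (^-monoʳ-< 2 ≤-refl (n<1+n (suc m)))

  n<2^n : ∀ n → n < 2 ^ n
  n<2^n zero    = z<s
  n<2^n (suc n) = ≤-<-trans (n<2^n n) (^-monoʳ-< 2 ≤-refl (n<1+n n))

  !≤^ : ∀ n → n ! ≤ suc n ^ n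
  !≤^ zero    = ≤-refl
  !≤^ (suc n) = *-mono-≤ (n≤1+n (suc n)) (≤-trans (!≤^ n) (^-monoˡ-≤ n (n≤1+n (suc n))))

  m<[1+m/n]*n : ∀ m n .{{_ : NonZero n}} → m < suc (m / n) * n
  m<[1+m/n]*n m n = subst (_< suc (m / n) * n) (sym (m≡m%n+[m/n]*n m n))
                      (+-monoˡ-< (m / n * n) (m%n<n m n))

  -- D and K of the construction for r = 2ᵏ.
  degree digitCount : ℕ → ℕ
  degree k     = pred (2 ^ k)
  digitCount k = 2 ^ (2 * k + 2)

  suc-degree : ∀ k → suc (degree k) ≡ 2 ^ k
  suc-degree k = suc-pred (2 ^ k) {{m^n≢0 2 k}}

  degree≤ : ∀ k → degree k ≤ 2 ^ k
  degree≤ k = pred[n]≤n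

  -- With D! ≤ r^D, the modulus is at most 2 to the power 1 + k (h + 1) D + k D. Since h ≥ 1 and k,
  -- D ≤ 2ᵏ, the exponent is at most h (1 + 3kD) ≤ 4 · 4ᵏ h, which explains the value of
  -- `digitCount`.
  modulus-≤ : ∀ k h → 1 ≤ h →
    Block.N (degree k) (digitCount k) (2 ^ h) (suc h) ≤ (2 ^ h) ^ digitCount k
  modulus-≤ k h 1≤h = begin
    2 * ((suc D ^ suc h) ^ D * D !)                 ≤⟨ *-monoʳ-≤ 2 (*-monoʳ-≤ ((suc D ^ suc h) ^ D) (!≤^ D)) ⟩
    2 * ((suc D ^ suc h) ^ D * suc D ^ D)           ≡⟨ cong (λ r → 2 * ((r ^ suc h) ^ D * r ^ D)) (suc-degree k) ⟩
    2 * (((2 ^ k) ^ suc h) ^ D * (2 ^ k) ^ D)       ≡⟨ cong₂ (λ x y → 2 * (x * y))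
        (trans (cong (_^ D) (^-*-assoc 2 k (suc h))) (^-*-assoc 2 (k * suc h) D)) (^-*-assoc 2 k D) ⟩
    2 * (2 ^ (k * suc h * D) * 2 ^ (k * D))         ≡⟨ cong (2 *_) (sym (^-distribˡ-+-* 2 (k * suc h * D) (k * D))) ⟩
    2 ^ suc (k * suc h * D + k * D)                 ≤⟨ ^-monoʳ-≤ 2 exponent ⟩
    2 ^ (h * digitCount k)                          ≡⟨ ^-*-assoc 2 h (digitCount k) ⟨
    (2 ^ h) ^ digitCount k                          ∎
    where
    open ≤-Reasoning
    D = degree k
    r = 2 ^ k
    collect : ∀ k h D → suc (k * suc h * D + k * D) ≡ 1 + k * D * h + 2 * (k * D)
    collect = solve-∀
    gather : ∀ h x → h * 1 + x * h + 2 * (x * h) ≡ h * (1 + 3 * x)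
    gather = solve-∀
    square : ∀ x → x * x + 3 * (x * x) ≡ x * x * 4
    square = solve-∀
    exponent : suc (k * suc h * D + k * D) ≤ h * digitCount k
    exponent = begin
      suc (k * suc h * D + k * D)              ≡⟨ collect k h D ⟩
      1 + k * D * h + 2 * (k * D)              ≤⟨ +-mono-≤ (+-monoˡ-≤ (k * D * h) (≤-trans 1≤h (≤-reflexive (sym (*-identityʳ h)))))
                                                    (*-monoʳ-≤ 2 (≤-trans (≤-reflexive (sym (*-identityʳ (k * D)))) (*-monoʳ-≤ (k * D) 1≤h))) ⟩
      h * 1 + k * D * h + 2 * (k * D * h)      ≡⟨ gather h (k * D) ⟩
      h * (1 + 3 * (k * D))                    ≤⟨ *-monoʳ-≤ h (+-mono-≤ (*-mono-≤ (m^n>0 2 k) (m^n>0 2 k))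
                                                    (*-monoʳ-≤ 3 (*-mono-≤ (<⇒≤ (n<2^n k)) (degree≤ k)))) ⟩
      h * (r * r + 3 * (r * r))                ≡⟨ cong (h *_) (square r) ⟩
      h * (r * r * 2 ^ 2)                      ≡⟨ cong (λ x → h * (x * 2 ^ 2)) (trans (cong (r *_) (cong (2 ^_) (sym (+-identityʳ k)))) (sym (^-distribˡ-+-* 2 k (k + 0)))) ⟩
      h * (2 ^ (2 * k) * 2 ^ 2)                ≡⟨ cong (h *_) (^-distribˡ-+-* 2 (2 * k) 2) ⟨
      h * digitCount k                         ∎

  -- The first summand pays for the gap between p and the box side, a factor 4 per coordinate and
  -- row, and for the level added to h. The second covers the primes below 2ᵏ.
  lossExponent : ℕ → ℕ → ℕ → ℕ
  lossExponent k d s = s * (2 * d + 1) + k * s * d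

  module _ {q : ℕ} (F : FiniteField q) (p s k : ℕ) (p-prime : Prime p) (q≡p^s : q ≡ p ^ s) where
    private instance
      _ = prime⇒nonZero p-prime

    q≢0 : NonZero q
    q≢0 = subst NonZero (sym q≡p^s) (m^n≢0 p s)

    -- For such p, q to the power of the dimension is bounded by the constant alone, and a single
    -- matched pair suffices.
    small-characteristic : ∀ d → p < 2 ^ k →
      q ^ (suc d * k) ≤ (IM F (suc d) * 2 ^ lossExponent k (suc d) s) ^ k * q ^ 2
    small-characteristic d p< = begin
      q ^ (suc d * k)               ≡⟨ ^-*-assoc q (suc d) k ⟨
      (q ^ suc d) ^ k               ≤⟨ ^-monoˡ-≤ k bound ⟩
      X ^ k                         ≤⟨ m≤m*n (X ^ k) (q ^ 2) {{m^n≢0 q 2 {{q≢0}}}} ⟩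
      X ^ k * q ^ 2                 ∎
      where
      open ≤-Reasoning
      X = IM F (suc d) * 2 ^ lossExponent k (suc d) s
      bound : q ^ suc d ≤ X
      bound = begin
        q ^ suc d                              ≡⟨ cong (_^ suc d) q≡p^s ⟩
        (p ^ s) ^ suc d                        ≤⟨ ^-monoˡ-≤ (suc d) (^-monoˡ-≤ s (<⇒≤ p<)) ⟩
        ((2 ^ k) ^ s) ^ suc d                  ≡⟨ trans (cong (_^ suc d) (^-*-assoc 2 k s)) (^-*-assoc 2 (k * s) (suc d)) ⟩
        2 ^ (k * s * suc d)                    ≤⟨ ^-monoʳ-≤ 2 (m≤n+m (k * s * suc d) (s * (2 * suc d + 1))) ⟩
        2 ^ lossExponent k (suc d) s           ≡⟨ *-identityˡ _ ⟨
        1 * 2 ^ lossExponent k (suc d) s       ≤⟨ *-monoˡ-≤ (2 ^ lossExponent k (suc d) s) (1≤IM F d) ⟩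
        X                                      ∎

    module _ (e h g : ℕ) (1≤h : 1 ≤ h) (hk≤m : h * k ≤ suc (h + g)) (m<[1+h]k : suc (h + g) < suc h * k)
             (2^m≤p : 2 ^ suc (h + g) ≤ p) (p<2^[1+m] : p < 2 ^ suc (suc (h + g))) where
      private
        d′ d : ℕ
        d′ = s * (degree k * (degree k * digitCount k)) + e
        d  = suc d′

      box-≤ : (2 ^ g * (2 ^ (h + g)) ^ d′) ^ s ≤ 2 ^ (s * suc h) * IM F d
      box-≤ = Construction.size-≤ F p s p-prime q≡p^s e (degree k) (digitCount k) h g (suc h)
        (modulus-≤ k h 1≤h) k (suc-degree k)
        -- With J = h + 1 levels, g ≤ m < (h + 1) k yields 2ᵍ ≤ r^J.
        (≤-trans (^-monoʳ-≤ 2 (≤-trans (m≤n+m g (suc h)) (≤-trans (<⇒≤ m<[1+h]k) (≤-reflexive (*-comm (suc h) k)))))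
          (≤-reflexive (trans (sym (^-*-assoc 2 k (suc h))) (cong (_^ suc h) (sym (suc-degree k))))))
        2^m≤p

      -- A factor 2^(s h) is lost to the colours and another 2^(s h) to the shorter first
      -- coordinates. As h k ≤ m and 2ᵐ ≤ p for m = h + g + 1, the k-th power of the product is at
      -- most q².
      large-characteristic : q ^ (d * k) ≤ (IM F d * 2 ^ lossExponent k d s) ^ k * q ^ 2
      large-characteristic = begin
        q ^ (d * k)                                  ≡⟨ ^-*-assoc q d k ⟨
        (q ^ d) ^ k                                  ≤⟨ ^-monoˡ-≤ k volume ⟩
        (X * 2 ^ (2 * s * h)) ^ k                    ≡⟨ *-^ X (2 ^ (2 * s * h)) k ⟩
        X ^ k * (2 ^ (2 * s * h)) ^ k                ≤⟨ *-monoʳ-≤ (X ^ k) saving ⟩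
        X ^ k * q ^ 2                                ∎
        where
        open ≤-Reasoning
        I = IM F d
        X = I * 2 ^ lossExponent k d s

        saving : (2 ^ (2 * s * h)) ^ k ≤ q ^ 2
        saving = begin
          (2 ^ (2 * s * h)) ^ k        ≡⟨ trans (^-*-assoc 2 (2 * s * h) k) (cong (2 ^_) (rearrange s h k)) ⟩
          2 ^ (h * k * (s * 2))        ≤⟨ ^-monoʳ-≤ 2 (*-monoˡ-≤ (s * 2) hk≤m) ⟩
          2 ^ (suc (h + g) * (s * 2))  ≡⟨ ^-*-assoc 2 (suc (h + g)) (s * 2) ⟨
          (2 ^ suc (h + g)) ^ (s * 2)  ≤⟨ ^-monoˡ-≤ (s * 2) 2^m≤p ⟩
          p ^ (s * 2)                  ≡⟨ trans (sym (^-*-assoc p s 2)) (cong (_^ 2) (sym q≡p^s)) ⟩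
          q ^ 2                        ∎
          where
          rearrange : ∀ s h k → 2 * s * h * k ≡ h * k * (s * 2)
          rearrange = solve-∀

        size≡ : (2 ^ g * (2 ^ (h + g)) ^ d′) ^ s ≡ 2 ^ ((g + (h + g) * d′) * s)
        size≡ = trans (cong (_^ s) (trans (cong (2 ^ g *_) (^-*-assoc 2 (h + g) d′))
                                   (sym (^-distribˡ-+-* 2 g ((h + g) * d′)))))
                      (^-*-assoc 2 (g + (h + g) * d′) s)

        volume : q ^ d ≤ X * 2 ^ (2 * s * h)
        volume = begin
          q ^ d                                               ≡⟨ cong (_^ d) q≡p^s ⟩
          (p ^ s) ^ d                                         ≤⟨ ^-monoˡ-≤ d (^-monoˡ-≤ s (<⇒≤ p<2^[1+m])) ⟩
          ((2 ^ suc (suc (h + g))) ^ s) ^ d                   ≡⟨ trans (cong (_^ d) (^-*-assoc 2 (suc (suc (h + g))) s)) (^-*-assoc 2 (suc (suc (h + g)) * s) d) ⟩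
          2 ^ (suc (suc (h + g)) * s * d)                     ≡⟨ cong (2 ^_) (split g h s d′) ⟩
          2 ^ ((g + (h + g) * d′) * s + s * (h + 2 * d))      ≡⟨ ^-distribˡ-+-* 2 ((g + (h + g) * d′) * s) (s * (h + 2 * d)) ⟩
          2 ^ ((g + (h + g) * d′) * s) * 2 ^ (s * (h + 2 * d)) ≤⟨ *-monoˡ-≤ (2 ^ (s * (h + 2 * d))) (subst (_≤ 2 ^ (s * suc h) * I) size≡ box-≤) ⟩
          2 ^ (s * suc h) * I * 2 ^ (s * (h + 2 * d))         ≡⟨ regroup (2 ^ (s * suc h)) I (2 ^ (s * (h + 2 * d))) ⟩
          I * (2 ^ (s * suc h) * 2 ^ (s * (h + 2 * d)))       ≡⟨ cong (I *_) (sym (^-distribˡ-+-* 2 (s * suc h) (s * (h + 2 * d)))) ⟩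
          I * 2 ^ (s * suc h + s * (h + 2 * d))               ≡⟨ cong (λ x → I * 2 ^ x) (merge s h d) ⟩
          I * 2 ^ (s * (2 * d + 1) + 2 * s * h)               ≤⟨ *-monoʳ-≤ I (^-monoʳ-≤ 2 (+-monoˡ-≤ (2 * s * h) (m≤m+n (s * (2 * d + 1)) (k * s * d)))) ⟩
          I * 2 ^ (lossExponent k d s + 2 * s * h)            ≡⟨ cong (I *_) (^-distribˡ-+-* 2 (lossExponent k d s) (2 * s * h)) ⟩
          I * (2 ^ lossExponent k d s * 2 ^ (2 * s * h))      ≡⟨ *-assoc I _ _ ⟨
          X * 2 ^ (2 * s * h)                                 ∎
          where
          split : ∀ g h s d′ → suc (suc (h + g)) * s * suc d′ ≡ (g + (h + g) * d′) * s + s * (h + 2 * suc d′)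
          split = solve-∀
          regroup : ∀ a b c → a * b * c ≡ b * (a * c)
          regroup = solve-∀
          merge : ∀ s h d → s * suc h + s * (h + 2 * d) ≡ s * (2 * d + 1) + 2 * s * h
          merge = solve-∀

    -- Take m = ⌊log₂ p⌋, h = ⌊m / k⌋ and g = m - h - 1. Here p ≥ 2ᵏ gives h ≥ 1, and together with
    -- k ≥ 2 this gives h < m, so that g exists.
    large-resolution : 2 ≤ k → ¬ p < 2 ^ k → ∀ e →
      let d = suc (s * (degree k * (degree k * digitCount k)) + e) in
      q ^ (d * k) ≤ (IM F d * 2 ^ lossExponent k d s) ^ k * q ^ 2
    large-resolution 2≤k p≮2^k e = large-characteristic e h g 1≤h
        (subst (h * k ≤_) (sym m≡) (m/n*n≤m m k))
        (subst (_< suc h * k) (sym m≡) (m<[1+m/n]*n m k))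
        (subst (λ x → 2 ^ x ≤ p) (sym m≡) 2^m≤p)
        (subst (λ x → p < 2 ^ suc x) (sym m≡) p<2^[1+m])
      where
      instance
        k≢0 : NonZero k
        k≢0 = >-nonZero (≤-trans (s≤s z≤n) 2≤k)
      m h : ℕ
      m = proj₁ (binaryLog (pred p))
      h = m / k
      2^m≤p : 2 ^ m ≤ p
      2^m≤p = subst (2 ^ m ≤_) (suc-pred p) (proj₁ (proj₂ (binaryLog (pred p))))
      p<2^[1+m] : p < 2 ^ suc m
      p<2^[1+m] = subst (_< 2 ^ suc m) (suc-pred p) (proj₂ (proj₂ (binaryLog (pred p))))
      k≤m : k ≤ m
      k≤m = ≮⇒≥ λ m<k → p≮2^k (<-≤-trans p<2^[1+m] (^-monoʳ-≤ 2 m<k))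
      1≤h : 1 ≤ h
      1≤h = n≢0⇒n>0 λ h≡0 → contradiction (m<[1+m/n]*n m k) (≤⇒≯ (subst (λ x → suc x * k ≤ m) (sym h≡0)
              (≤-trans (≤-reflexive (+-identityʳ k)) k≤m)))
      h<m : h < m
      h<m = ≤-trans (≤-trans (+-monoˡ-≤ h 1≤h) (≤-trans (≤-reflexive (cong (h +_) (sym (+-identityʳ h))))
              (≤-trans (≤-reflexive (*-comm 2 h)) (*-monoʳ-≤ h 2≤k)))) (m/n*n≤m m k)
      g : ℕ
      g = proj₁ (m≤n⇒∃[o]m+o≡n h<m)
      m≡ : suc h + g ≡ m
      m≡ = proj₂ (m≤n⇒∃[o]m+o≡n h<m)

    many-dimensions : 2 ≤ k → ∀ d → s * (degree k * (degree k * digitCount k)) < d →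
      q ^ (d * k) ≤ (IM F d * 2 ^ lossExponent k d s) ^ k * q ^ 2
    many-dimensions 2≤k d n<d = by-cases d (m≤n⇒∃[o]m+o≡n n<d) (p <? 2 ^ k)
      where
      by-cases : ∀ d → ∃ (λ e → suc (s * (degree k * (degree k * digitCount k))) + e ≡ d) → Dec (p < 2 ^ k) →
        q ^ (d * k) ≤ (IM F d * 2 ^ lossExponent k d s) ^ k * q ^ 2
      by-cases d (e , refl) (yes p<2^k) = small-characteristic (s * (degree k * (degree k * digitCount k)) + e) p<2^k
      by-cases d (e , refl) (no  p≮2^k) = large-resolution 2≤k p≮2^k e

  logFloor : ℕ → ℕ
  logFloor d = proj₁ (binaryLog (pred d))

  -- The construction needs s D² K < d. With D ≤ 2ᵏ, K = 2^(2k + 2) and s < 2ˢ it is enough that s +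
  -- 4k + 2 is at most the binary logarithm of d. The maximum with 1 keeps 2 / k meaningful when d
  -- is small compared with 2ˢ.
  resolution : ℕ → ℕ → ℕ
  resolution d s = 1 ⊔ (logFloor d ∸ (s + 4)) / 4

  resolution≥1 : ∀ d s → 1 ≤ resolution d s
  resolution≥1 d s = m≤m⊔n 1 ((logFloor d ∸ (s + 4)) / 4)

  logFloor-bounds : ∀ d → 1 ≤ d → 2 ^ logFloor d ≤ d × d < 2 ^ suc (logFloor d)
  logFloor-bounds (suc d) _ = proj₂ (binaryLog d)

  -- The additive terms are absorbed into s k by s ≥ 2 and k ≥ 1. The shape is that of 2 / k ≤ 30 s
  -- / (2 (L + 1)), where L + 1 will bound log d.
  log-≤-resolution : ∀ d s → 2 ≤ s → 4 * suc (logFloor d) ≤ 30 * s * resolution d s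
  log-≤-resolution d s 2≤s = begin
    4 * suc L                                   ≤⟨ *-monoʳ-≤ 4 L< ⟩
    4 * (s + 4 + suc κ * 4)                     ≡⟨ expand s κ ⟩
    4 * (s * 1) + 32 * 1 * 1 + 8 * (2 * κ)      ≤⟨ +-mono-≤ (+-mono-≤ (*-monoʳ-≤ 4 (*-monoʳ-≤ s 1≤k))
                                                     (*-mono-≤ (*-monoʳ-≤ 16 2≤s) 1≤k)) (*-monoʳ-≤ 8 (*-mono-≤ 2≤s (m≤n⊔m 1 κ))) ⟩
    4 * (s * k) + 16 * s * k + 8 * (s * k)      ≡⟨ collect s k ⟩
    28 * s * k                                  ≤⟨ *-monoˡ-≤ k (*-monoˡ-≤ s (m≤n+m 28 2)) ⟩
    30 * s * k                                  ∎
    where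
    open ≤-Reasoning
    L = logFloor d
    κ = (L ∸ (s + 4)) / 4
    k = resolution d s
    1≤k = resolution≥1 d s
    L< : L < s + 4 + suc κ * 4
    L< = ≤-<-trans (m≤n+m∸n L (s + 4)) (+-monoʳ-< (s + 4) (m<[1+m/n]*n (L ∸ (s + 4)) 4))
    expand : ∀ s κ → 4 * (s + 4 + suc κ * 4) ≡ 4 * (s * 1) + 32 * 1 * 1 + 8 * (2 * κ)
    expand = solve-∀
    collect : ∀ s k → 4 * (s * k) + 16 * s * k + 8 * (s * k) ≡ 28 * s * k
    collect = solve-∀

  -- With ℓ the loss exponent, this is q^(d - 2/k) ≤ 2^ℓ IM raised to the k-th power, which keeps it
  -- within ℕ. The colouring gives it for k ≥ 2, a hyperplane for k = 1.
  IM-lower-bound : ∀ s d → 3 ≤ d → ∀ {p q} → Prime p → q ≡ p ^ s → (F : FiniteField q) →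
    let k = resolution d s in
    q ^ (d * k) ≤ (IM F d * 2 ^ lossExponent k d s) ^ k * q ^ 2
  IM-lower-bound s (suc d) 3≤d {p} {q} p-prime q≡p^s F =
    by-cases (2 ≤? (logFloor (suc d) ∸ (s + 4)) / 4)
    where
    open ≤-Reasoning
    L κ : ℕ
    L = logFloor (suc d)
    κ = (L ∸ (s + 4)) / 4
    4κ≤ : 2 ≤ κ → s + 4 + κ * 4 ≤ L
    4κ≤ 2≤κ = ≤-trans (+-monoʳ-≤ (s + 4) (m/n*n≤m (L ∸ (s + 4)) 4)) (≤-reflexive (m+[n∸m]≡n (<⇒≤ (m∸n≢0⇒n<m {L} {s + 4} nonzero))))
      where
      nonzero : L ∸ (s + 4) ≢ 0
      nonzero e = contradiction (subst (λ x → 2 ≤ x / 4) e 2≤κ) λ ()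
    expand : ∀ s κ → s + (κ + (κ + (2 * κ + 2))) + 2 ≡ s + 4 + κ * 4
    expand = solve-∀
    enough : 2 ≤ κ → s * (degree κ * (degree κ * digitCount κ)) < suc d
    enough 2≤κ = begin-strict
      s * (degree κ * (degree κ * digitCount κ))     ≤⟨ *-monoʳ-≤ s (*-mono-≤ (degree≤ κ) (*-monoˡ-≤ (digitCount κ) (degree≤ κ))) ⟩
      s * (2 ^ κ * (2 ^ κ * 2 ^ (2 * κ + 2)))        ≡⟨ cong (s *_) (trans (cong (2 ^ κ *_) (sym (^-distribˡ-+-* 2 κ (2 * κ + 2)))) (sym (^-distribˡ-+-* 2 κ (κ + (2 * κ + 2))))) ⟩
      s * 2 ^ (κ + (κ + (2 * κ + 2)))                <⟨ *-monoˡ-< (2 ^ (κ + (κ + (2 * κ + 2)))) {{m^n≢0 2 (κ + (κ + (2 * κ + 2)))}} (n<2^n s) ⟩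
      2 ^ s * 2 ^ (κ + (κ + (2 * κ + 2)))            ≡⟨ ^-distribˡ-+-* 2 s (κ + (κ + (2 * κ + 2))) ⟨
      2 ^ (s + (κ + (κ + (2 * κ + 2))))              ≤⟨ ^-monoʳ-≤ 2 (≤-trans (m≤m+n _ 2) (≤-trans (≤-reflexive (expand s κ)) (4κ≤ 2≤κ))) ⟩
      2 ^ L                                          ≤⟨ proj₁ (logFloor-bounds (suc d) (s≤s z≤n)) ⟩
      suc d                                          ∎
    Goal : ℕ → Set
    Goal k = q ^ (suc d * k) ≤ (IM F (suc d) * 2 ^ lossExponent k (suc d) s) ^ k * q ^ 2
    instance
      _ = q≢0 F p s 1 p-prime q≡p^s
    -- For k = 1 a loss of q² is allowed, and the hyperplane loses a factor q.
    coarse : Goal 1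
    coarse = begin
      q ^ (suc d * 1)              ≡⟨ trans (cong (q ^_) (*-identityʳ (suc d))) (*-comm q (q ^ d)) ⟩
      q ^ d * q                    ≤⟨ *-mono-≤ (hyperplane-≤-IM F d) (≤-trans (m≤m*n q q) (≤-reflexive (cong (q *_) (sym (*-identityʳ q))))) ⟩
      IM F (suc d) * q ^ 2         ≤⟨ *-monoˡ-≤ (q ^ 2) (m≤m*n (IM F (suc d)) (2 ^ ℓ) {{m^n≢0 2 ℓ}}) ⟩
      IM F (suc d) * 2 ^ ℓ * q ^ 2 ≡⟨ cong (_* q ^ 2) (sym (*-identityʳ (IM F (suc d) * 2 ^ ℓ))) ⟩
      (IM F (suc d) * 2 ^ ℓ) ^ 1 * q ^ 2 ∎
      where ℓ = lossExponent 1 (suc d) s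
    by-cases : Dec (2 ≤ κ) → Goal (resolution (suc d) s)
    by-cases (yes 2≤κ) = subst Goal (sym (m≤n⇒m⊔n≡n (≤-trans (s≤s z≤n) 2≤κ)))
      (many-dimensions F p s κ p-prime q≡p^s 2≤κ (suc d) (enough 2≤κ))
    by-cases (no 2≰κ)  = subst Goal (sym (m≥n⇒m⊔n≡m (≤-pred (≰⇒> 2≰κ)))) coarse

-- From natural numbers to the cuts for logarithms, products and real powers.

module RationalCuts where
  open import Data.Integer using (ℤ; +_; -[1+_])
  import Data.Integer.Tactic.RingSolver as ℤSolver
  open import Data.Rational as ℚ using (ℚ; mkℚ; 0ℚ; 1ℚ; ½; _/_; toℚᵘ; ↥_; ↧ₙ_; _⊔_)
  import Data.Rational.Properties as ℚ
  open import Data.Rational.Unnormalised as ℚᵘ using (ℚᵘ; mkℚᵘ; *≡*; *≤*; *<*)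
  import Data.Rational.Unnormalised.Properties as ℚᵘ
  open ≡ using (refl; sym; trans; cong; cong₂; subst; subst₂)
  open LevelColouring using (*-^)

  toℚᵘ-/ : ∀ a b .{{_ : NonZero b}} → toℚᵘ (+ a / b) ℚᵘ.≃ (+ a ℚᵘ./ b)
  toℚᵘ-/ a (suc b) = ℚ.toℚᵘ-fromℚᵘ (mkℚᵘ (+ a) b)

  /-mono-≤ : ∀ a b c d .{{_ : NonZero b}} .{{_ : NonZero d}} → a ℕ.* d ℕ.≤ c ℕ.* b → + a / b ℚ.≤ + c / d
  /-mono-≤ a (suc b) c (suc d) le = ℚ.toℚᵘ-cancel-≤
    (ℚᵘ.≤-respˡ-≃ (ℚᵘ.≃-sym (toℚᵘ-/ a (suc b))) (ℚᵘ.≤-respʳ-≃ (ℚᵘ.≃-sym (toℚᵘ-/ c (suc d)))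
      (*≤* (subst₂ ℤ._≤_ (ℤ.pos-* a (suc d)) (ℤ.pos-* c (suc b)) (ℤ.+≤+ le)))))

  /-mono-< : ∀ a b c d .{{_ : NonZero b}} .{{_ : NonZero d}} → a ℕ.* d ℕ.< c ℕ.* b → + a / b ℚ.< + c / d
  /-mono-< a (suc b) c (suc d) lt = ℚ.toℚᵘ-cancel-<
    (ℚᵘ.<-respˡ-≃ (ℚᵘ.≃-sym (toℚᵘ-/ a (suc b))) (ℚᵘ.<-respʳ-≃ (ℚᵘ.≃-sym (toℚᵘ-/ c (suc d)))
      (*<* (subst₂ ℤ._<_ (ℤ.pos-* a (suc d)) (ℤ.pos-* c (suc b)) (ℤ.+<+ lt)))))

  /-* : ∀ a b c d .{{_ : NonZero b}} .{{_ : NonZero d}} →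
        (+ a / b) ℚ.* (+ c / d) ≡ _/_ (+ (a ℕ.* c)) (b ℕ.* d) {{ℕ.m*n≢0 b d}}
  /-* a (suc b) c (suc d) = ℚ.toℚᵘ-injective (ℚᵘ.≃-trans (ℚ.toℚᵘ-homo-* (+ a / suc b) (+ c / suc d))
    (ℚᵘ.≃-trans (ℚᵘ.*-cong (toℚᵘ-/ a (suc b)) (toℚᵘ-/ c (suc d)))
    (ℚᵘ.≃-trans (*≡* (cong (ℤ._* + (suc b ℕ.* suc d)) (sym (ℤ.pos-* a c))))
      (ℚᵘ.≃-sym (toℚᵘ-/ (a ℕ.* c) (suc b ℕ.* suc d))))))

  /-cancel-< : ∀ a b c d .{{_ : NonZero b}} .{{_ : NonZero d}} → + a / b ℚ.< + c / d → a ℕ.* d ℕ.< c ℕ.* b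
  /-cancel-< a b c d lt = ℕ.≰⇒> λ le → ℚ.<-irrefl refl (ℚ.<-≤-trans lt (/-mono-≤ c d a b le))

  ℕ⇒ℚ-* : ∀ m n → ℕ⇒ℚ m ℚ.* ℕ⇒ℚ n ≡ ℕ⇒ℚ (m ℕ.* n)
  ℕ⇒ℚ-* m n = /-* m 1 n 1

  ℕ⇒ℚ-^ : ∀ m n → ℕ⇒ℚ m ^ℚ n ≡ ℕ⇒ℚ (m ℕ.^ n)
  ℕ⇒ℚ-^ m zero    = refl
  ℕ⇒ℚ-^ m (suc n) = trans (cong (ℕ⇒ℚ m ℚ.*_) (ℕ⇒ℚ-^ m n)) (ℕ⇒ℚ-* m (m ℕ.^ n))

  ℕ⇒ℚ-mono-≤ : ∀ {m n} → m ℕ.≤ n → ℕ⇒ℚ m ℚ.≤ ℕ⇒ℚ n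
  ℕ⇒ℚ-mono-≤ {m} {n} le = /-mono-≤ m 1 n 1 (ℕ.*-monoˡ-≤ 1 le)

  ℕ⇒ℚ-mono-< : ∀ {m n} → m ℕ.< n → ℕ⇒ℚ m ℚ.< ℕ⇒ℚ n
  ℕ⇒ℚ-mono-< {m} {n} lt = /-mono-< m 1 n 1 (ℕ.*-monoˡ-< 1 lt)

  ℕ⇒ℚ-cancel-< : ∀ {m n} → ℕ⇒ℚ m ℚ.< ℕ⇒ℚ n → m ℕ.< n
  ℕ⇒ℚ-cancel-< {m} {n} lt = ℕ.*-cancelʳ-< 1 m n (/-cancel-< m 1 n 1 lt)

  ℕ⇒ℚ≥0 : ∀ n → 0ℚ ℚ.≤ ℕ⇒ℚ n
  ℕ⇒ℚ≥0 n = ℕ⇒ℚ-mono-≤ {0} {n} z≤n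

  *-mono-≤ : ∀ {a b c d} → 0ℚ ℚ.≤ a → 0ℚ ℚ.≤ d → a ℚ.≤ b → c ℚ.≤ d → a ℚ.* c ℚ.≤ b ℚ.* d
  *-mono-≤ {a} {b} {c} {d} 0≤a 0≤d a≤b c≤d = ℚ.≤-trans
    (ℚ.*-monoˡ-≤-nonNeg a {{ℚ.nonNegative 0≤a}} c≤d) (ℚ.*-monoʳ-≤-nonNeg d {{ℚ.nonNegative 0≤d}} a≤b)

  0≤^ : ∀ {a} n → 0ℚ ℚ.≤ a → 0ℚ ℚ.≤ a ^ℚ n
  0≤^ zero    0≤a = ℕ⇒ℚ≥0 1
  0≤^ {a} (suc n) 0≤a = ℚ.≤-trans (ℚ.≤-reflexive (sym (ℚ.*-zeroʳ a))) (*-mono-≤ 0≤a (0≤^ n 0≤a) ℚ.≤-refl (0≤^ n 0≤a))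

  ^-mono-≤ : ∀ {a b} n → 0ℚ ℚ.≤ a → a ℚ.≤ b → a ^ℚ n ℚ.≤ b ^ℚ n
  ^-mono-≤ zero    0≤a a≤b = ℚ.≤-refl
  ^-mono-≤ (suc n) 0≤a a≤b = *-mono-≤ 0≤a (0≤^ n (ℚ.≤-trans 0≤a a≤b)) a≤b (^-mono-≤ n 0≤a a≤b)

  -1<0 : ℚ.- 1ℚ ℚ.< 0ℚ
  -1<0 = ℚ.*<* ℤ.-<+

  fromℚ-isDedekind : ∀ a → IsDedekind (fromℚ a)
  fromℚ-isDedekind a = record
    { lower-inhabited = a ℚ.+ ℚ.- 1ℚ , subst (a ℚ.+ ℚ.- 1ℚ ℚ.<_) (ℚ.+-identityʳ a) (ℚ.+-monoʳ-< a -1<0)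
    ; upper-inhabited = a ℚ.+ 1ℚ , subst (ℚ._< a ℚ.+ 1ℚ) (ℚ.+-identityʳ a) (ℚ.+-monoʳ-< a (ℕ⇒ℚ-mono-< {0} {1} ℕ.z<s))
    ; lower-rounded   = λ r → mk⇔ ℚ.<-dense (λ (t , r<t , t<a) → ℚ.<-trans r<t t<a)
    ; upper-rounded   = λ r → mk⇔ (λ a<r → let (t , a<t , t<r) = ℚ.<-dense a<r in t , t<r , a<t)
                                 (λ (t , t<r , a<t) → ℚ.<-trans a<t t<r)
    ; disjoint        = λ r (r<a , a<r) → ℚ.<-asym r<a a<r
    ; located         = λ r t r<t → located r t r<t
    }
    where
    located : ∀ r t → r ℚ.< t → r ℚ.< a ⊎ a ℚ.< t
    located r t r<t with r ℚ.<? a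
    ... | yes r<a = inj₁ r<a
    ... | no  r≮a = inj₂ (ℚ.≤-<-trans (ℚ.≮⇒≥ r≮a) r<t)

  rational : ℚ → ℝ
  rational a = record { cut = fromℚ a ; isDedekind = fromℚ-isDedekind a }

  rational-positive : ∀ {a} → 0ℚ ℚ.< a → fromℕ 0 <ᶜ fromℚ a
  rational-positive = ℚ.<-dense

  -- Taking m = r = u + 1 in the definition of `log` turns (1 + r/m)^m into 2^(u + 1).
  log-Upper : ∀ d u → d ℕ.< 2 ℕ.^ suc u → Upper (log d) (ℕ⇒ℚ (suc u))
  log-Upper d u d< = u ,
    ℚ.<-≤-trans (ℚ.neg-antimono-< (ℕ⇒ℚ-mono-< {0} {suc u} ℕ.z<s)) (ℕ⇒ℚ≥0 (suc u)) ,
    subst (ℕ⇒ℚ d ℚ.<_) (trans (sym (ℕ⇒ℚ-^ 2 (suc u)))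
      (cong (λ x → (1ℚ ℚ.+ x) ^ℚ suc u) (sym cancel))) (ℕ⇒ℚ-mono-< d<)
    where
    cancel : ℕ⇒ℚ (suc u) ℚ.* (+ 1 / suc u) ≡ 1ℚ
    cancel = trans (/-* (suc u) 1 1 (suc u)) (ℚ.≤-antisym
      (/-mono-≤ (suc u ℕ.* 1) (1 ℕ.* suc u) 1 1 (ℕ.≤-reflexive (identity u)))
      (/-mono-≤ 1 1 (suc u ℕ.* 1) (1 ℕ.* suc u) (ℕ.≤-reflexive (sym (identity u)))))
      where
      identity : ∀ u → suc u ℕ.* 1 ℕ.* 1 ≡ 1 ℕ.* (1 ℕ.* suc u)
      identity = ℕSolver.solve-∀

  -- The case m = 1: 1 < d (1 - ½). A positive lower bound for log d is what the upper part of
  -- `recip⁺` requires.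
  log-Lower : ∀ d → 3 ℕ.≤ d → Lower (log d) ½
  log-Lower d 3≤d = 0 , ℚ.*<* (ℤ.+<+ (s≤s (s≤s z≤n))) ,
    ℚ.<-≤-trans (/-mono-< 1 1 3 2 (s≤s (s≤s (s≤s z≤n))))
      (ℚ.*-monoʳ-≤-nonNeg ½ (ℕ⇒ℚ-mono-≤ 3≤d))

  -- Products of cuts need strict bounds on each factor. Here 30 s lies below 62 s and 1 / (2 (u +
  -- 1)) below 1 / log d, and their product, the least corner, is still at least 2 / k.
  2/k-≤-62s/log : ∀ k s d u .{{_ : NonZero k}} → 2 ℕ.≤ s → 3 ℕ.≤ d → d ℕ.< 2 ℕ.^ suc u →
    4 ℕ.* suc u ℕ.≤ 30 ℕ.* s ℕ.* k → fromℚ (+ 2 / k) ≤ᶜ (fromℕ 62 *ᶜ fromℕ s) /ᶜ log d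
  2/k-≤-62s/log k s@(suc s′@(suc s″)) d u (s≤s (s≤s _)) 3≤d d< 4u≤ r r<2/k =
    ℕ⇒ℚ a , ℕ⇒ℚ a′ , b , ℕ⇒ℚ 3 ,
    -- The factors 62 and s are enclosed in (61, 63) and (s - 1, s + 1). The least corner 61 (s - 1)
    -- exceeds 30 s for all s ≥ 2, by just 1 at s = 2; this is the origin of 62.
    ((ℕ⇒ℚ 61 , ℕ⇒ℚ 63 , ℕ⇒ℚ s′ , ℕ⇒ℚ (suc s) ,
       (ℕ⇒ℚ-mono-< (ℕ.n<1+n 61) , ℕ⇒ℚ-mono-< (ℕ.n<1+n 62) , ℕ⇒ℚ-mono-< (ℕ.n<1+n s′) , ℕ⇒ℚ-mono-< (ℕ.n<1+n s)) ,
       below 61 s′ a<₁ , below 61 (suc s) (ℕ.<-≤-trans a<₁ (ℕ.*-monoʳ-≤ 61 s′≤)) ,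
       below 63 s′ (ℕ.<-≤-trans a<₁ (ℕ.*-monoˡ-≤ s′ (ℕ.m≤n+m 61 2))) ,
       below 63 (suc s) (ℕ.<-≤-trans a<₁ (ℕ.*-mono-≤ (ℕ.m≤n+m 61 2) s′≤))) ,
     (ℕ⇒ℚ 61 , ℕ⇒ℚ 63 , ℕ⇒ℚ s′ , ℕ⇒ℚ (suc s) ,
       (ℕ⇒ℚ-mono-< (ℕ.n<1+n 61) , ℕ⇒ℚ-mono-< (ℕ.n<1+n 62) , ℕ⇒ℚ-mono-< (ℕ.n<1+n s′) , ℕ⇒ℚ-mono-< (ℕ.n<1+n s)) ,
       above 61 s′ (s≤s (ℕ.*-mono-≤ (ℕ.m≤n+m 61 2) s′≤)) , above 61 (suc s) (s≤s (ℕ.*-monoˡ-≤ (suc s) (ℕ.m≤n+m 61 2))) ,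
       above 63 s′ (s≤s (ℕ.*-monoʳ-≤ 63 s′≤)) , above 63 (suc s) ℕ.≤-refl) ,
     -- Since log d < u + 1 and b (u + 1) = ½ < 1, b is below 1 / log d. Since ½ < log d and 1 < 3 ·
     -- ½, 3 is above it.
     (ℕ⇒ℚ (suc u) , log-Upper d u d< ,
       subst (ℚ._< 1ℚ) (sym (/-* 1 (2 ℕ.* suc u) (suc u) 1))
         (/-mono-< (1 ℕ.* suc u) (2 ℕ.* suc u ℕ.* 1) 1 1 {{ℕ.m*n≢0 (2 ℕ.* suc u) 1}} half)) ,
     (½ , log-Lower d 3≤d , ℚ.*<* (ℤ.+<+ (s≤s z≤n)) , /-mono-< 1 1 3 2 (s≤s (s≤s (s≤s z≤n))))) ,
    ℚ.<-≤-trans r<2/k corner ,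
    ℚ.<-≤-trans r<2/k (ℚ.≤-trans corner (ℚ.*-monoˡ-≤-nonNeg (ℕ⇒ℚ a) {{ℚ.nonNegative (ℕ⇒ℚ≥0 a)}} b≤3)) ,
    ℚ.<-≤-trans r<2/k (ℚ.≤-trans corner (ℚ.*-monoʳ-≤-nonNeg b {{ℚ.nonNegative 0≤b}} a≤a′)) ,
    ℚ.<-≤-trans r<2/k (ℚ.≤-trans corner (*-mono-≤ (ℕ⇒ℚ≥0 a) (ℕ⇒ℚ≥0 3) a≤a′ b≤3))
    where
    a a′ : ℕ
    a  = 30 ℕ.* s
    a′ = suc (63 ℕ.* suc s)
    b = + 1 / (2 ℕ.* suc u)
    s′≤ : s′ ℕ.≤ suc s
    s′≤ = ℕ.m≤n+m s′ 2
    a<₁ : a ℕ.< 61 ℕ.* s′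
    a<₁ = subst (suc a ℕ.≤_) (identity s″) (ℕ.m≤m+n (suc a) (31 ℕ.* s″))
      where
      identity : ∀ x → suc (30 ℕ.* suc (suc x)) ℕ.+ 31 ℕ.* x ≡ 61 ℕ.* suc x
      identity = ℕSolver.solve-∀
    below : ∀ m n → a ℕ.< m ℕ.* n → ℕ⇒ℚ a ℚ.< ℕ⇒ℚ m ℚ.* ℕ⇒ℚ n
    below m n lt = subst (ℕ⇒ℚ a ℚ.<_) (sym (ℕ⇒ℚ-* m n)) (ℕ⇒ℚ-mono-< lt)
    above : ∀ m n → m ℕ.* n ℕ.< a′ → ℕ⇒ℚ m ℚ.* ℕ⇒ℚ n ℚ.< ℕ⇒ℚ a′
    above m n lt = subst (ℚ._< ℕ⇒ℚ a′) (sym (ℕ⇒ℚ-* m n)) (ℕ⇒ℚ-mono-< lt)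
    half : 1 ℕ.* suc u ℕ.* 1 ℕ.< 1 ℕ.* (2 ℕ.* suc u ℕ.* 1)
    half = subst₂ ℕ._<_ (left u) (right u) (ℕ.m<m+n (suc u) ℕ.z<s)
      where
      left : ∀ u → suc u ≡ 1 ℕ.* suc u ℕ.* 1
      left = ℕSolver.solve-∀
      right : ∀ u → suc u ℕ.+ suc u ≡ 1 ℕ.* (2 ℕ.* suc u ℕ.* 1)
      right = ℕSolver.solve-∀
    b≤3 : b ℚ.≤ ℕ⇒ℚ 3
    b≤3 = /-mono-≤ 1 (2 ℕ.* suc u) 3 1 (s≤s z≤n)
    0≤b : 0ℚ ℚ.≤ b
    0≤b = /-mono-≤ 0 1 1 (2 ℕ.* suc u) z≤n
    a≤a′ : ℕ⇒ℚ a ℚ.≤ ℕ⇒ℚ a′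
    a≤a′ = ℕ⇒ℚ-mono-≤ (ℕ.≤-trans (ℕ.<⇒≤ a<₁) (ℕ.≤-trans (ℕ.*-mono-≤ (ℕ.m≤n+m 61 2) s′≤) (ℕ.n≤1+n _)))
    corner : + 2 / k ℚ.≤ ℕ⇒ℚ a ℚ.* b
    corner = subst (+ 2 / k ℚ.≤_) (sym (/-* a 1 1 (2 ℕ.* suc u)))
      (/-mono-≤ 2 k (a ℕ.* 1) (1 ℕ.* (2 ℕ.* suc u)) (subst₂ ℕ._≤_ (left u) (cong (ℕ._* k) (sym (ℕ.*-identityʳ a))) 4u≤))
      where
      left : ∀ u → 4 ℕ.* suc u ≡ 2 ℕ.* (1 ℕ.* (2 ℕ.* suc u))
      left = ℕSolver.solve-∀

  sign-parts : ∀ z → z ℤ.+ + ℤ.∣ ℤ.- z ℤ.⊔ + 0 ∣ ≡ + ℤ.∣ z ℤ.⊔ + 0 ∣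
  sign-parts (+ zero)   = refl
  sign-parts (+ suc n)  = trans (ℤ.+-identityʳ (+ suc n)) refl
  sign-parts -[1+ n ]   = ℤ.+-inverseˡ (+ suc n)

  -- Raising the first inequality to the power n and the second to the power k eliminates Z: q^(mn +
  -- bk) ≤ (Zⁿ q^b)^k q^(2n) < q^(ak + 2n).
  exponent-≤ : ∀ q Z k m a b n .{{_ : NonZero k}} .{{_ : NonZero q}} →
    q ℕ.^ m ℕ.≤ Z ℕ.^ k ℕ.* q ℕ.^ 2 → Z ℕ.^ n ℕ.* q ℕ.^ b ℕ.< q ℕ.^ a →
    m ℕ.* n ℕ.+ b ℕ.* k ℕ.< a ℕ.* k ℕ.+ 2 ℕ.* n
  exponent-≤ q Z k m a b n lower upper = ℕ.≰⇒> λ le → ℕ.<⇒≱ raised (ℕ.^-monoʳ-≤ q le)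
    where
    open ℕ.≤-Reasoning
    raised : q ℕ.^ (m ℕ.* n ℕ.+ b ℕ.* k) ℕ.< q ℕ.^ (a ℕ.* k ℕ.+ 2 ℕ.* n)
    raised = begin-strict
      q ℕ.^ (m ℕ.* n ℕ.+ b ℕ.* k)                       ≡⟨ ℕ.^-distribˡ-+-* q (m ℕ.* n) (b ℕ.* k) ⟩
      q ℕ.^ (m ℕ.* n) ℕ.* q ℕ.^ (b ℕ.* k)               ≡⟨ cong₂ ℕ._*_ (ℕ.^-*-assoc q m n) (ℕ.^-*-assoc q b k) ⟨
      (q ℕ.^ m) ℕ.^ n ℕ.* (q ℕ.^ b) ℕ.^ k               ≤⟨ ℕ.*-monoˡ-≤ ((q ℕ.^ b) ℕ.^ k) (ℕ.^-monoˡ-≤ n lower) ⟩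
      (Z ℕ.^ k ℕ.* q ℕ.^ 2) ℕ.^ n ℕ.* (q ℕ.^ b) ℕ.^ k   ≡⟨ cong (ℕ._* (q ℕ.^ b) ℕ.^ k) (*-^ (Z ℕ.^ k) (q ℕ.^ 2) n) ⟩
      (Z ℕ.^ k) ℕ.^ n ℕ.* (q ℕ.^ 2) ℕ.^ n ℕ.* (q ℕ.^ b) ℕ.^ k
        ≡⟨ cong (λ x → x ℕ.* (q ℕ.^ 2) ℕ.^ n ℕ.* (q ℕ.^ b) ℕ.^ k)
             (trans (ℕ.^-*-assoc Z k n) (trans (cong (Z ℕ.^_) (ℕ.*-comm k n)) (sym (ℕ.^-*-assoc Z n k)))) ⟩
      (Z ℕ.^ n) ℕ.^ k ℕ.* (q ℕ.^ 2) ℕ.^ n ℕ.* (q ℕ.^ b) ℕ.^ k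
        ≡⟨ swap ((Z ℕ.^ n) ℕ.^ k) ((q ℕ.^ 2) ℕ.^ n) ((q ℕ.^ b) ℕ.^ k) ⟩
      (Z ℕ.^ n) ℕ.^ k ℕ.* (q ℕ.^ b) ℕ.^ k ℕ.* (q ℕ.^ 2) ℕ.^ n
        ≡⟨ cong (ℕ._* (q ℕ.^ 2) ℕ.^ n) (*-^ (Z ℕ.^ n) (q ℕ.^ b) k) ⟨
      (Z ℕ.^ n ℕ.* q ℕ.^ b) ℕ.^ k ℕ.* (q ℕ.^ 2) ℕ.^ n
        <⟨ ℕ.*-monoˡ-< ((q ℕ.^ 2) ℕ.^ n) {{ℕ.m^n≢0 (q ℕ.^ 2) n {{ℕ.m^n≢0 q 2}}}} (ℕ.^-monoˡ-< k upper) ⟩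
      (q ℕ.^ a) ℕ.^ k ℕ.* (q ℕ.^ 2) ℕ.^ n               ≡⟨ cong₂ ℕ._*_ (ℕ.^-*-assoc q a k) (ℕ.^-*-assoc q 2 n) ⟩
      q ℕ.^ (a ℕ.* k) ℕ.* q ℕ.^ (2 ℕ.* n)               ≡⟨ ℕ.^-distribˡ-+-* q (a ℕ.* k) (2 ℕ.* n) ⟨
      q ℕ.^ (a ℕ.* k ℕ.+ 2 ℕ.* n)                       ∎
      where
      swap : ∀ x y z → x ℕ.* y ℕ.* z ≡ x ℕ.* z ℕ.* y
      swap = ℕSolver.solve-∀

  -- Clears denominators, with the numerator of `t` written as the difference of its positive and
  -- negative parts; the negative part moves to the right-hand side to stay in ℕ.
  parts-< : ∀ t k d .{{_ : NonZero k}} → t ℚ.+ + 2 / k ℚ.< ℕ⇒ℚ d →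
    ℤ.∣ ↥ t ℤ.⊔ + 0 ∣ ℕ.* k ℕ.+ 2 ℕ.* ↧ₙ t ℕ.< d ℕ.* k ℕ.* ↧ₙ t ℕ.+ ℤ.∣ ℤ.- (↥ t) ℤ.⊔ + 0 ∣ ℕ.* k
  parts-< t@(mkℚ z n-1 _) k@(suc _) d lt = ℤ.drop‿+<+ (subst₂ ℤ._<_ left right
    (ℤ.+-monoˡ-< (+ b ℤ.* + k) (integral (ℚᵘ.<-respˡ-≃ (ℚᵘ.≃-trans (ℚ.toℚᵘ-homo-+ t (+ 2 / k)) (ℚᵘ.+-congʳ (toℚᵘ t) (toℚᵘ-/ 2 k)))
      (ℚᵘ.<-respʳ-≃ (toℚᵘ-/ d 1) (ℚ.toℚᵘ-mono-< lt))))))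
    where
    n a b : ℕ
    n = suc n-1
    a = ℤ.∣ z ℤ.⊔ + 0 ∣
    b = ℤ.∣ ℤ.- z ℤ.⊔ + 0 ∣
    integral : mkℚᵘ z n-1 ℚᵘ.+ (+ 2 ℚᵘ./ k) ℚᵘ.< (+ d ℚᵘ./ 1) →
               (z ℤ.* + k ℤ.+ + 2 ℤ.* + n) ℤ.* + 1 ℤ.< + d ℤ.* (+ n ℤ.* + k)
    integral (*<* lt) = subst (λ x → (z ℤ.* + k ℤ.+ + 2 ℤ.* + n) ℤ.* + 1 ℤ.< + d ℤ.* x) (ℤ.pos-* n k) lt
    left : (z ℤ.* + k ℤ.+ + 2 ℤ.* + n) ℤ.* + 1 ℤ.+ + b ℤ.* + k ≡ + (a ℕ.* k ℕ.+ 2 ℕ.* n)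
    left = trans (collect z (+ k) (+ n) (+ b)) (trans (cong (λ x → x ℤ.* + k ℤ.+ + 2 ℤ.* + n) (sign-parts z))
      (sym (trans (ℤ.pos-+ (a ℕ.* k) (2 ℕ.* n)) (cong₂ ℤ._+_ (ℤ.pos-* a k) (ℤ.pos-* 2 n)))))
      where
      collect : ∀ z k n b → (z ℤ.* k ℤ.+ + 2 ℤ.* n) ℤ.* + 1 ℤ.+ b ℤ.* k ≡ (z ℤ.+ b) ℤ.* k ℤ.+ + 2 ℤ.* n
      collect = ℤSolver.solve-∀
    right : + d ℤ.* (+ n ℤ.* + k) ℤ.+ + b ℤ.* + k ≡ + (d ℕ.* k ℕ.* n ℕ.+ b ℕ.* k)
    right = sym (trans (ℤ.pos-+ (d ℕ.* k ℕ.* n) (b ℕ.* k)) (cong₂ ℤ._+_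
      (trans (ℤ.pos-* (d ℕ.* k) n) (trans (cong (ℤ._* + n) (ℤ.pos-* d k)) (rotate (+ d) (+ k) (+ n)))) (ℤ.pos-* b k)))
      where
      rotate : ∀ d k n → d ℤ.* k ℤ.* n ≡ d ℤ.* (n ℤ.* k)
      rotate = ℤSolver.solve-∀

  -- If Z ≤ r, the inequality defining `BelowPower` also holds with Z in place of r, and then
  -- `exponent-≤` contradicts `parts-<`. No real root has to be taken.
  below-power-< : ∀ q Z k d .{{_ : NonZero k}} .{{_ : NonZero q}} → q ℕ.^ (d ℕ.* k) ℕ.≤ Z ℕ.^ k ℕ.* q ℕ.^ 2 →
    ∀ t → t ℚ.+ + 2 / k ℚ.< ℕ⇒ℚ d → ∀ r → BelowPower q t r → r ℚ.< ℕ⇒ℚ Z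
  below-power-< q Z k d lower t t+2/k<d r below = ℚ.≰⇒> λ Z≤r →
    ℕ.<-asym (parts-< t k d t+2/k<d) (exponent-≤ q Z k (d ℕ.* k) a⁺ a⁻ n lower
      (ℕ⇒ℚ-cancel-< (subst₂ ℚ._<_ (trans (cong₂ ℚ._*_ (ℕ⇒ℚ-^ Z n) (ℕ⇒ℚ-^ q a⁻)) (ℕ⇒ℚ-* (Z ℕ.^ n) (q ℕ.^ a⁻)))
        (ℕ⇒ℚ-^ q a⁺) (ℚ.≤-<-trans (*-mono-≤ (0≤^ n (ℕ⇒ℚ≥0 Z)) (0≤^ a⁻ (ℕ⇒ℚ≥0 q))
          (^-mono-≤ n (ℕ⇒ℚ≥0 Z) (ℚ.≤-trans Z≤r (ℚ.p≤q⊔p 0ℚ r))) ℚ.≤-refl) below))))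
    where
    n a⁺ a⁻ : ℕ
    n  = ↧ₙ t
    a⁺ = ℤ.∣ ↥ t ℤ.⊔ + 0 ∣
    a⁻ = ℤ.∣ ℤ.- (↥ t) ℤ.⊔ + 0 ∣

  exponent-below : ∀ d ε t → Lower (fromℕ d -ᶜ fromℚ ε) t → t ℚ.+ ε ℚ.< ℕ⇒ℚ d
  exponent-below d ε t (a , b , a<d , ε<b , t<a-b) = ℚ.<-trans (ℚ.+-mono-< t<a-b ε<b)
    (subst (ℚ._< ℕ⇒ℚ d) (sym cancel) a<d)
    where
    cancel : a ℚ.- b ℚ.+ b ≡ a
    cancel = trans (ℚ.+-assoc a (ℚ.- b) b) (trans (cong (a ℚ.+_) (ℚ.+-inverseˡ b)) (ℚ.+-identityʳ a))

  scaled-power-≤ : ∀ q I e k d .{{_ : NonZero k}} .{{_ : NonZero q}} →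
    q ℕ.^ (d ℕ.* k) ℕ.≤ (I ℕ.* 2 ℕ.^ e) ℕ.^ k ℕ.* q ℕ.^ 2 →
    fromℚ (_/_ (+ 1) (2 ℕ.^ e) {{ℕ.m^n≢0 2 e}}) *ᶜ (q ^ᶜ (fromℕ d -ᶜ fromℚ (+ 2 / k))) ≤ᶜ fromℕ I
  scaled-power-≤ q I e k d lower r
    (a , a′ , b , b′ , (a<c , c<a′ , (t , t< , below) , _) , r<ab , _ , r<a′b , _) with ℚ.≤-total b 0ℚ
  -- The lower bound b for the power need not be positive. If it is not, the corner a′ b is at most
  -- 0, as a′ exceeds the positive constant.
  ... | inj₁ b≤0 = ℚ.<-≤-trans r<a′b (ℚ.≤-trans
    (subst (a′ ℚ.* b ℚ.≤_) (ℚ.*-zeroʳ a′) (ℚ.*-monoˡ-≤-nonNeg a′ {{ℚ.nonNegative 0≤a′}} b≤0)) (ℕ⇒ℚ≥0 I))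
    where
    0≤a′ : 0ℚ ℚ.≤ a′
    0≤a′ = ℚ.≤-trans (/-mono-≤ 0 1 1 (2 ℕ.^ e) {{_}} {{ℕ.m^n≢0 2 e}} z≤n) (ℚ.<⇒≤ c<a′)
  -- Now a b ≤ c b ≤ c (I 2ᵉ) = I with c = 2⁻ᵉ.
  ... | inj₂ 0≤b = ℚ.<-≤-trans r<ab (ℚ.≤-trans
    (ℚ.*-monoʳ-≤-nonNeg b {{ℚ.nonNegative 0≤b}} (ℚ.<⇒≤ a<c))
    (ℚ.≤-trans (ℚ.*-monoˡ-≤-nonNeg c {{ℚ.nonNegative 0≤c}} (ℚ.<⇒≤
      (below-power-< q (I ℕ.* 2 ℕ.^ e) k d lower t (exponent-below d (+ 2 / k) t t<) b below)))
      (subst (ℚ._≤ ℕ⇒ℚ I) (sym (/-* 1 (2 ℕ.^ e) (I ℕ.* 2 ℕ.^ e) 1))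
        (/-mono-≤ (1 ℕ.* (I ℕ.* 2 ℕ.^ e)) (2 ℕ.^ e ℕ.* 1) I 1 {{ℕ.m*n≢0 (2 ℕ.^ e) 1}} (ℕ.≤-reflexive (identity I (2 ℕ.^ e)))))))
    where
    instance _ = ℕ.m^n≢0 2 e
    c = + 1 / (2 ℕ.^ e)
    0≤c : 0ℚ ℚ.≤ c
    0≤c = /-mono-≤ 0 1 1 (2 ℕ.^ e) z≤n
    identity : ∀ i x → 1 ℕ.* (i ℕ.* x) ℕ.* 1 ≡ i ℕ.* (x ℕ.* 1)
    identity = ℕSolver.solve-∀

-- The constants: C = 62, ε = 2 / k and c a negative power of two.

open import Data.Integer using (+_)
open import Data.Rational using (ℚ; _/_)
open import Data.Nat using (_≤_; _<_; _^_)
open LowerBound using (resolution; resolution≥1; lossExponent; logFloor; logFloor-bounds; log-≤-resolution; IM-lower-bound)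
open RationalCuts using (rational; rational-positive; /-mono-<; ℕ⇒ℚ-mono-<; 2/k-≤-62s/log; scaled-power-≤)

exponent factor : ℕ → ℕ → ℚ
exponent d s = (+ 2 / resolution d s) {{ℕ.>-nonZero (resolution≥1 d s)}}
factor d s   = (+ 1 / (2 ^ e)) {{ℕ.m^n≢0 2 e}}
  where e = lossExponent (resolution d s) d s

corollary1p7 : Σ[ C ∈ ℝ ] Σ[ ε ∈ (ℕ → ℕ → ℝ) ] Σ[ c ∈ (ℕ → ℕ → ℝ) ]
    fromℕ 0 <ᶜ cut C ×
    (∀ s d → 2 ≤ s → 3 ≤ d →
    fromℕ 0 <ᶜ cut (ε d s) ×
    fromℕ 0 <ᶜ cut (c d s) ×
    cut (ε d s) ≤ᶜ (cut C *ᶜ fromℕ s) /ᶜ log d) ×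
    (∀ s d → 2 ≤ s → 3 ≤ d →
    ∀ p q → Prime p → s < p → q ≡ p ^ s →
    (F : FiniteField q) →
    cut (c d s) *ᶜ (q ^ᶜ (fromℕ d -ᶜ cut (ε d s))) ≤ᶜ fromℕ (IM F d))
corollary1p7 =
  rational (ℕ⇒ℚ 62) , (λ d s → rational (exponent d s)) , (λ d s → rational (factor d s)) ,
  rational-positive (ℕ⇒ℚ-mono-< {0} {62} ℕ.z<s) ,
  (λ s d 2≤s 3≤d →
    let instance _ = ℕ.>-nonZero (resolution≥1 d s)
                 _ = ℕ.m^n≢0 2 (lossExponent (resolution d s) d s)
    in rational-positive (/-mono-< 0 1 2 (resolution d s) ℕ.z<s) ,
       rational-positive (/-mono-< 0 1 1 (2 ^ lossExponent (resolution d s) d s) ℕ.z<s) ,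
       2/k-≤-62s/log (resolution d s) s d (logFloor d) 2≤s 3≤d
         (proj₂ (logFloor-bounds d (ℕ.≤-trans (s≤s z≤n) 3≤d))) (log-≤-resolution d s 2≤s)) ,
  (λ s d 2≤s 3≤d p q p-prime s<p q≡p^s F →
    scaled-power-≤ q (IM F d) (lossExponent (resolution d s) d s) (resolution d s) d
      {{ℕ.>-nonZero (resolution≥1 d s)}} {{LowerBound.q≢0 F p s 1 p-prime q≡p^s}}
      (IM-lower-bound s d 3≤d p-prime q≡p^s F))
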